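{- Let $k\ge 2$ be an integer. If a graph $G$ satisfies $\operatorname{og}(G)\ge 2k+1$ and $\operatorname{mad}(G)<2+\frac1k$, then $G$ has a $(2k+1:k)$-coloring.
   Context: All graphs are finite and simple. For positive integers $a\ge b$, an $(a:b)$-coloring of $G$ assigns to each vertex of $G$ a $b$-element subset of $[a]=\{1,\ldots,a\}$ so that adjacent vertices receive disjoint sets. The odd girth $\operatorname{og}(G)$ is the length of a shortest odd cycle of $G$, with $\operatorname{og}(G)=\infty$ if $G$ is bipartite. The maximum average degree is $\operatorname{mad}(G)=\max_{H}\frac{2|E(H)|}{|V(H)|}$, where the maximum is over all subgraphs $H\subseteq G$ with at least one vertex. -}

module Defs where

open import Data.Empty using (⊥)
open import Data.Fin.Base using (Fin)
open import Data.Fin.Properties using (_≟_; _<?_)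
open import Data.Fin.Subset using (Subset; Empty; _∩_; ∣_∣)
open import Data.Integer.Base using (+_)
open import Data.List.Base
  using (List; []; _∷_; _∷ʳ_; _++_; length; map; filter; concatMap; upTo;
         allFin; cartesianProduct; cartesianProductWith)
open import Data.List.Membership.Propositional using (_∈_)
open import Data.List.Membership.DecPropositional using (_∈?_)
open import Data.List.Relation.Unary.All using (All; all?)
open import Data.List.Relation.Unary.Linked using (Linked; linked?)
open import Data.List.Relation.Unary.Unique.Propositional using (Unique)
open import Data.List.Relation.Unary.Unique.DecPropositional using (unique?)
open import Data.Nat.Base using (ℕ; zero; suc; _≤_; _*_; _%_)
import Data.Nat.Properties as ℕ
open import Data.Product.Base using (_×_; _,_)
open import Data.Rational.Base using (ℚ; 0ℚ; _/_)
import Data.Rational.Properties as ℚ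
open import Function.Base using (_∘_)
open import Level using (0ℓ)
open import Relation.Binary.Bundles using (DecTotalOrder; TotalOrder)
open import Relation.Binary.Core using (Rel)
open import Relation.Binary.Definitions using (Decidable; Symmetric; Irreflexive)
open import Relation.Binary.PropositionalEquality using (_≡_)
open import Relation.Nullary.Construct.Add.Supremum using (_⁺; [_]; ⊤⁺)
open import Relation.Nullary.Decidable using (Dec; no; _×-dec_)

open import Relation.Binary.Construct.Add.Supremum.NonStrict _≤_ public
  using (_≤⁺_) renaming (≤⁺-isTotalOrder-≡ to ≤⁺-isTotalOrder)

record Graph : Set₁ where
  field
    order : ℕ

  Vertex : Set
  Vertex = Fin order

  field
    Adj    : Rel Vertex 0ℓ
    adj?   : Decidable Adj
    sym    : Symmetric Adj
    irrefl : Irreflexive _≡_ Adj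

record Coloring (a b : ℕ) (G : Graph) : Set where
  open Graph G
  field
    color    : Vertex → Subset a
    size     : ∀ v → ∣ color v ∣ ≡ b
    disjoint : ∀ {u v} → Adj u v → Empty (color u ∩ color v)

-- ℕ ∪ {∞}, with ⊤⁺ as ∞.
ℕ∞ : Set
ℕ∞ = ℕ ⁺

ℕ∞-totalOrder : TotalOrder 0ℓ 0ℓ 0ℓ
ℕ∞-totalOrder = record { isTotalOrder = ≤⁺-isTotalOrder ℕ.≤-isTotalOrder }

open import Data.List.Extrema ℕ∞-totalOrder using (min)
open import Data.List.Extrema (DecTotalOrder.totalOrder ℚ.≤-decTotalOrder) using (max)

words : ∀ {A : Set} → List A → ℕ → List (List A)
words xs zero    = [] ∷ []
words xs (suc ℓ) = cartesianProductWith _∷_ xs (words xs ℓ)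

-- All subsequences; when the entries of xs are distinct, each subset of xs
-- is listed exactly once.
sublists : ∀ {A : Set} → List A → List (List A)
sublists []       = [] ∷ []
sublists (x ∷ xs) = map (x ∷_) (sublists xs) ++ sublists xs

module _ (G : Graph) where
  open Graph G

  -- A cycle is given by its vertices in cyclic order, without repeating the
  -- starting vertex; its length is the length of this list.
  IsCycle : List Vertex → Set
  IsCycle []       = ⊥
  IsCycle (v ∷ vs) =
    3 ≤ length (v ∷ vs) × Unique (v ∷ vs) × Linked Adj (v ∷ (vs ∷ʳ v))

  isCycle? : ∀ c → Dec (IsCycle c)
  isCycle? []       = no λ ()
  isCycle? (v ∷ vs) =
    (3 ℕ.≤? length (v ∷ vs)) ×-dec unique? _≟_ (v ∷ vs)
      ×-dec linked? adj? (v ∷ (vs ∷ʳ v))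

  -- The vertices of a cycle are distinct, so no cycle is longer than the
  -- order of the graph.
  cycles : List (List Vertex)
  cycles = filter isCycle? (concatMap (words (allFin order)) (upTo (suc order)))

  oddCycles : List (List Vertex)
  oddCycles = filter (λ c → length c % 2 ℕ.≟ 1) cycles

  -- The value is ∞ when there is no odd cycle, i.e. when G is bipartite.
  oddGirth : ℕ∞
  oddGirth = min ⊤⁺ (map ([_] ∘ length) oddCycles)

  -- Each edge is listed once, with its smaller endpoint first.
  edges : List (Vertex × Vertex)
  edges = filter (λ (u , v) → (u <? v) ×-dec adj? u v)
                 (cartesianProduct (allFin order) (allFin order))

  IsSubgraph : List Vertex × List (Vertex × Vertex) → Set
  IsSubgraph (W , F) = 1 ≤ length W × All (λ (u , v) → u ∈ W × v ∈ W) F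

  isSubgraph? : ∀ H → Dec (IsSubgraph H)
  isSubgraph? (W , F) =
    (1 ℕ.≤? length W)
      ×-dec all? (λ (u , v) → (_∈?_ _≟_ u W) ×-dec (_∈?_ _≟_ v W)) F

  -- All subgraphs with at least one vertex, not only the induced ones.
  subgraphs : List (List Vertex × List (Vertex × Vertex))
  subgraphs =
    filter isSubgraph? (cartesianProduct (sublists (allFin order)) (sublists edges))

  -- The first clause is a junk value: subgraphs have a vertex.
  averageDegree : List Vertex × List (Vertex × Vertex) → ℚ
  averageDegree ([]         , F) = 0ℚ
  averageDegree (W@(_ ∷ _) , F) = + (2 * length F) / length W

  -- Average degrees are nonnegative, so the base value 0 only matters for the
  -- graph without vertices, whose mad is thereby 0.
  mad : ℚ
  mad = max 0ℚ (map averageDegree subgraphs)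

module Submission where

-- Let L = 2k + 1.  In a coloring u ↦ A_u, a walk of even (odd) length ℓ from u to w forces A_u and
-- A_w to agree (to disagree) in at least L − ℓ of the L coordinates.  So let an even (odd) edge of
-- weight a > 0 between u and w demand a such coordinates; an edge of G is an odd edge of weight 2k.
-- The bound on mad says that the edges inside any nonempty vertex set W weigh less than L |W|.
--
-- Some vertex v has total weight less than 2L.  Delete it, and for any two edges at v, of weights
-- a and b, add an edge of weight a + b − L between their other ends (a walk through v).  For
-- numbers in [0, L] with sum s ≤ 2L, the excesses over L of all pairs add up to at most s − L,
-- if s ≥ L, and to 0 otherwise; so the density condition survives, and induction applies.  The
-- odd girth enters as: an even and an odd edge between the same vertices weigh at most L together.
--
-- It remains to choose A_v, that is, to choose k of 2k + 1 coordinates so that |A_v ∩ S_i| ≥ n_i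
-- for given sets S_i (the A_u and complements of A_u for the neighbours u of v), where the new
-- edges guarantee |S_i ∩ S_j| ≥ n_i + n_j − k.  Coordinates are chosen or rejected one at a time:
-- when r choices and q rejections remain, z_i of which must be made outside S_i, one keeps
-- Σ n_i ≤ 2r, Σ z_i ≤ 2q and the pair conditions by following two sets at every step.

open import Defs
open import Relation.Nullary.Construct.Add.Supremum using ([_])

module Proof where

  open import Data.Bool.Base using (Bool; true; false; not; _∧_; _xor_; if_then_else_)
  open import Data.Bool.Properties
    using (∧-comm; ∧-identityʳ; not-involutive; not-distribˡ-xor; xor-assoc; xor-comm; xor-identityʳ; xor-same)
    renaming (_≟_ to _≟ᵇ_)
  open import Data.Fin.Base using (Fin)
  import Data.Fin.Base as Fin
  import Data.Fin.Properties as Fin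
  open import Data.Fin.Subset using (Subset; ∣_∣; _∩_; Empty) renaming (_∈_ to _∈ˢ_)
  open import Data.Fin.Subset.Properties using (x∈p∩q⁻)
  import Data.Integer.Base as ℤ
  import Data.Integer.Properties as ℤ
  open import Data.List.Base
    using (List; []; _∷_; _++_; _∷ʳ_; length; map; filter; allFin; tabulate; cartesianProduct)
  open import Data.List.Membership.DecPropositional using (_∈?_)
  open import Data.List.Membership.Propositional using (_∈_; _∉_; find; lose)
  open import Data.List.Membership.Propositional.Properties
    using (∈-∃++; ∈-filter⁺; ∈-filter⁻; ∈-map⁺; ∈-++⁺ˡ; ∈-++⁺ʳ; ∈-concatMap⁺; ∈-cartesianProductWith⁺;
           ∈-cartesianProduct⁺; ∈-cartesianProduct⁻; ∈-upTo⁺; ∈-allFin)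
  open import Data.List.Properties using (length-++; length-map; length-tabulate; filter-notAll; map-tabulate)
  open import Data.List.Relation.Binary.Permutation.Propositional as Perm
    using (_↭_; ↭-refl; ↭-sym; ↭-trans; prep; ↭⇒↭ₛ)
  open import Data.List.Relation.Binary.Permutation.Propositional.Properties
    using (shift; ∈-resp-↭; ↭-length; ++-comm; ++⁺ʳ; ++-assoc) renaming (++-identityʳ to ↭-++-identityʳ)
  import Data.List.Relation.Binary.Permutation.Setoid.Properties as Permutation
  open import Data.List.Relation.Unary.All using (All; []; _∷_)
  import Data.List.Relation.Unary.All as All
  import Data.List.Relation.Unary.All.Properties as All
  open import Data.List.Relation.Unary.AllPairs using ([]; _∷_)
  open import Data.List.Relation.Unary.Any using (here; there; any?)
  import Data.List.Relation.Unary.Any as Any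
  open import Data.List.Relation.Unary.Linked using (Linked; []; [-]; _∷_)
  open import Data.List.Relation.Unary.Unique.Propositional using (Unique)
  import Data.List.Relation.Unary.Unique.Propositional.Properties as Unique
  open import Data.Nat.Base hiding (_/_)
  open import Data.Nat.DivMod using ([m+n]%n≡m%n)
  open import Data.Nat.ListAction using (sum)
  open import Data.Nat.Properties renaming (_≟_ to _≟ℕ_)
  open import Data.Nat.Tactic.RingSolver using (solve-∀)
  open import Data.Product.Base using (∃; ∃₂; _×_; _,_; proj₁; proj₂; swap)
  open import Data.Product.Properties using (≡-dec)
  import Data.Rational.Base as ℚ
  open ℚ using (toℚᵘ)
  import Data.Rational.Properties as ℚ
  import Data.Rational.Unnormalised.Base as ℚᵘ
  open ℚᵘ using (mkℚᵘ)
  import Data.Rational.Unnormalised.Properties as ℚᵘ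
  open import Data.Sum.Base using (_⊎_; inj₁; inj₂)
  import Data.Vec.Base as Vec
  import Data.Vec.Properties as Vec
  open import Function.Base using (_∘_; id)
  open import Relation.Binary.Bundles using (DecTotalOrder)
  import Relation.Binary.Construct.Add.Supremum.NonStrict _≤_ as Sup
  open import Relation.Binary.Definitions using (DecidableEquality; tri<; tri≈; tri>)
  open import Relation.Binary.PropositionalEquality hiding ([_]; J)
  open import Relation.Nullary using (¬_; Dec; yes; no; does; contradiction)
  open import Relation.Nullary.Decidable using (_×-dec_; ¬?)
  open import Relation.Unary using (Decidable)
  open import Data.List.Extrema ℕ∞-totalOrder using (min≤xs)
  open import Data.List.Extrema (DecTotalOrder.totalOrder ℚ.≤-decTotalOrder) using (xs≤max)

  -- Linear consequences of one inequality reduce to a semiring identity, with slack s.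
  linear : ∀ {a b m n} s → a ≤ b → m + b + s ≡ n + a → m ≤ n
  linear {a} {b} {m} {n} s a≤b eq = +-cancelʳ-≤ b m n
    (≤-trans (m≤m+n (m + b) s) (≤-trans (≤-reflexive eq) (+-monoʳ-≤ n a≤b)))

  -- Sums and counts over lists

  ⟦_⟧ : Bool → ℕ
  ⟦ true ⟧ = 1
  ⟦ false ⟧ = 0

  module _ {A : Set} where

    ∑ : (A → ℕ) → List A → ℕ
    ∑ f xs = sum (map f xs)

    count : (A → Bool) → List A → ℕ
    count p = ∑ (λ x → ⟦ p x ⟧)

    ∑-mono : ∀ {f g} xs → (∀ {x} → x ∈ xs → f x ≤ g x) → ∑ f xs ≤ ∑ g xs
    ∑-mono [] h = z≤n
    ∑-mono (x ∷ xs) h = +-mono-≤ (h (here refl)) (∑-mono xs (h ∘ there))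

    ∑-mono-< : ∀ {f g x} xs → (∀ {x} → x ∈ xs → f x ≤ g x) → x ∈ xs → f x < g x →
               ∑ f xs < ∑ g xs
    ∑-mono-< (x ∷ xs) h (here refl) fx<gx = +-mono-<-≤ fx<gx (∑-mono xs (h ∘ there))
    ∑-mono-< (x ∷ xs) h (there x∈) fx<gx = +-mono-≤-< (h (here refl)) (∑-mono-< xs (h ∘ there) x∈ fx<gx)

    ∑-cong : ∀ {f g} xs → (∀ {x} → x ∈ xs → f x ≡ g x) → ∑ f xs ≡ ∑ g xs
    ∑-cong [] h = refl
    ∑-cong (x ∷ xs) h = cong₂ _+_ (h (here refl)) (∑-cong xs (h ∘ there))

    ∑-+ : ∀ f g xs → ∑ (λ x → f x + g x) xs ≡ ∑ f xs + ∑ g xs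
    ∑-+ f g [] = refl
    ∑-+ f g (x ∷ xs) rewrite ∑-+ f g xs = interchange (f x) (g x) (∑ f xs) (∑ g xs)
      where
      interchange : ∀ a b c d → a + b + (c + d) ≡ a + c + (b + d)
      interchange = solve-∀

    ∑-≤-* : ∀ {f m} xs → (∀ {x} → x ∈ xs → f x ≤ m) → ∑ f xs ≤ length xs * m
    ∑-≤-* [] h = z≤n
    ∑-≤-* (x ∷ xs) h = +-mono-≤ (h (here refl)) (∑-≤-* xs (h ∘ there))

    ∑-1 : ∀ xs → ∑ (λ _ → 1) xs ≡ length xs
    ∑-1 [] = refl
    ∑-1 (x ∷ xs) = cong suc (∑-1 xs)

    ∑-++ : ∀ f xs {ys} → ∑ f (xs ++ ys) ≡ ∑ f xs + ∑ f ys
    ∑-++ f [] = refl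
    ∑-++ f (x ∷ xs) = trans (cong (f x +_) (∑-++ f xs)) (sym (+-assoc (f x) _ _))

    ∑-↭ : ∀ f {xs ys} → xs ↭ ys → ∑ f xs ≡ ∑ f ys
    ∑-↭ f Perm.refl = refl
    ∑-↭ f (Perm.prep x p) = cong (f x +_) (∑-↭ f p)
    ∑-↭ f (Perm.swap {xs} {ys} x y p) rewrite ∑-↭ f p = swap-heads (f x) (f y) (∑ f ys)
      where
      swap-heads : ∀ a b c → a + (b + c) ≡ b + (a + c)
      swap-heads = solve-∀
    ∑-↭ f (Perm.trans p q) = trans (∑-↭ f p) (∑-↭ f q)

    ∑-filter-≤ : ∀ f {P : A → Set} (P? : Decidable P) xs → ∑ f (filter P? xs) ≤ ∑ f xs
    ∑-filter-≤ f P? [] = z≤n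
    ∑-filter-≤ f P? (x ∷ xs) with P? x
    ... | yes _ = +-monoʳ-≤ (f x) (∑-filter-≤ f P? xs)
    ... | no _ = m≤n⇒m≤o+n (f x) (∑-filter-≤ f P? xs)

    ∈⇒↭ : ∀ {x : A} {xs} → x ∈ xs → ∃ λ xs′ → xs ↭ x ∷ xs′
    ∈⇒↭ x∈ with ys , zs , refl ← ∈-∃++ x∈ = ys ++ zs , shift _ ys zs

    ∑-⊆ : ∀ f {xs ys} → Unique xs → (∀ {x} → x ∈ xs → x ∈ ys) → ∑ f xs ≤ ∑ f ys
    ∑-⊆ f {[]} _ _ = z≤n
    ∑-⊆ f {x ∷ xs} {ys} (x∉ ∷ u) xs⊆ys with zs , p ← ∈⇒↭ (xs⊆ys (here refl)) =
      ≤-trans (+-monoʳ-≤ (f x) (∑-⊆ f u xs⊆zs)) (≤-reflexive (sym (∑-↭ f p)))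
      where
      xs⊆zs : ∀ {y} → y ∈ xs → y ∈ zs
      xs⊆zs y∈ with ∈-resp-↭ p (xs⊆ys (there y∈))
      ... | here refl = contradiction refl (All.lookup x∉ y∈)
      ... | there y∈zs = y∈zs

    length-⊆ : ∀ {xs ys : List A} → Unique xs → (∀ {x} → x ∈ xs → x ∈ ys) → length xs ≤ length ys
    length-⊆ {xs} {ys} u h = subst₂ _≤_ (∑-1 xs) (∑-1 ys) (∑-⊆ (λ _ → 1) u h)

    ∈⇒≤∑ : ∀ f {x xs} → x ∈ xs → f x ≤ ∑ f xs
    ∈⇒≤∑ f (here refl) = m≤m+n _ _
    ∈⇒≤∑ f {xs = y ∷ _} (there x∈) = m≤n⇒m≤o+n (f y) (∈⇒≤∑ f x∈)

    count>0⇒∃ : ∀ p xs → 0 < count p xs → ∃ λ x → x ∈ xs × p x ≡ true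
    count>0⇒∃ p (x ∷ xs) c>0 with p x in px
    ... | true = x , here refl , px
    ... | false with y , y∈ , py ← count>0⇒∃ p xs c>0 = y , there y∈ , py

    ∃⇒count>0 : ∀ p {x xs} → x ∈ xs → p x ≡ true → 0 < count p xs
    ∃⇒count>0 p x∈ px = ≤-trans (≤-reflexive (cong ⟦_⟧ (sym px))) (∈⇒≤∑ (λ x → ⟦ p x ⟧) x∈)

    count-not : ∀ p xs → count (not ∘ p) xs + count p xs ≡ length xs
    count-not p xs = trans (sym (∑-+ (λ x → ⟦ not (p x) ⟧) (λ x → ⟦ p x ⟧) xs))
      (trans (∑-cong xs (λ {x} _ → go (p x))) (∑-1 xs))
      where
      go : ∀ b → ⟦ not b ⟧ + ⟦ b ⟧ ≡ 1
      go true = refl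
      go false = refl

    -- Inclusion-exclusion for two predicates, written without subtraction.
    count-neither : ∀ p q xs → count (λ x → not (p x) ∧ not (q x)) xs + (count p xs + count q xs)
                             ≡ length xs + count (λ x → p x ∧ q x) xs
    count-neither p q [] = refl
    count-neither p q (x ∷ xs) = combine (p x) (q x) _ _ (count p xs) (count q xs) (length xs) (count-neither p q xs)
      where
      e₁ : ∀ a b c → a + (suc b + suc c) ≡ suc (suc (a + (b + c)))
      e₁ = solve-∀
      e₂ : ∀ a b → suc a + suc b ≡ suc (suc (a + b))
      e₂ = solve-∀
      e₃ : ∀ a b c → a + (b + suc c) ≡ suc (a + (b + c))
      e₃ = solve-∀
      e₄ : ∀ a b c → a + (suc b + c) ≡ suc (a + (b + c))
      e₄ = solve-∀
      combine : ∀ b c n o s t l → n + (s + t) ≡ l + o →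
                ⟦ not b ∧ not c ⟧ + n + (⟦ b ⟧ + s + (⟦ c ⟧ + t)) ≡ suc l + (⟦ b ∧ c ⟧ + o)
      combine true true n o s t l h = trans (e₁ n s t) (trans (cong (suc ∘ suc) h) (sym (e₂ l o)))
      combine true false n o s t l h = trans (e₄ n s t) (cong suc h)
      combine false true n o s t l h = trans (e₃ n s t) (cong suc h)
      combine false false n o s t l h = cong suc h

  module _ {C : Set} where
    -- An element that satisfies m of the three predicates satisfies at least m - 1 of their
    -- pairwise conjunctions.
    count-three : ∀ (a b c : C → Bool) xs →
      count a xs + (count b xs + count c xs) ≤
      length xs + (count (λ x → a x ∧ b x) xs + (count (λ x → b x ∧ c x) xs + count (λ x → a x ∧ c x) xs))
    count-three a b c [] = z≤n
    count-three a b c (x ∷ xs) = combine ⟦ a x ⟧ ⟦ b x ⟧ ⟦ c x ⟧ _ _ _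
      ⟦ a x ∧ b x ⟧ ⟦ b x ∧ c x ⟧ ⟦ a x ∧ c x ⟧ (length xs) _ _ _
      (pointwise (a x) (b x) (c x)) (count-three a b c xs)
      where
      pointwise : ∀ a b c → ⟦ a ⟧ + (⟦ b ⟧ + ⟦ c ⟧) ≤ 1 + (⟦ a ∧ b ⟧ + (⟦ b ∧ c ⟧ + ⟦ a ∧ c ⟧))
      pointwise true true true = s≤s (s≤s (s≤s z≤n))
      pointwise true true false = s≤s (s≤s z≤n)
      pointwise true false true = s≤s (s≤s z≤n)
      pointwise true false false = s≤s z≤n
      pointwise false true true = s≤s (s≤s z≤n)
      pointwise false true false = s≤s z≤n
      pointwise false false true = s≤s z≤n
      pointwise false false false = z≤n
      combine : ∀ a b c s t u p q r l o v w → a + (b + c) ≤ 1 + (p + (q + r)) →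
                s + (t + u) ≤ l + (o + (v + w)) →
                (a + s) + ((b + t) + (c + u)) ≤ suc l + ((p + o) + ((q + v) + (r + w)))
      combine a b c s t u p q r l o v w h k = subst₂ _≤_ (e₁ a b c s t u) (e₂ p q r l o v w) (+-mono-≤ h k)
        where
        e₁ : ∀ a b c s t u → a + (b + c) + (s + (t + u)) ≡ (a + s) + ((b + t) + (c + u))
        e₁ = solve-∀
        e₂ : ∀ p q r l o v w → 1 + (p + (q + r)) + (l + (o + (v + w))) ≡ suc l + ((p + o) + ((q + v) + (r + w)))
        e₂ = solve-∀

  -- Choosing elements under demands

  module Selections {K C : Set} (_≟_ : DecidableEquality K) where

    both neither : (K → C → Bool) → K → K → C → Bool
    both S i j c = S i c ∧ S j c
    neither S i j c = not (S i c) ∧ not (S j c)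

    lower : (K → Bool) → (K → ℕ) → K → ℕ
    lower b n i = n i ∸ ⟦ b i ⟧

    record Selection (S : K → C → Bool) (X : List C) (r : ℕ) (J : List K) (n : K → ℕ) : Set where
      field
        chosen rejected : List C
        split  : X ↭ chosen ++ rejected
        size   : length chosen ≡ r
        enough : ∀ {i} → i ∈ J → n i ≤ count (S i) chosen

    -- If the demands add up to at most r, no element has to serve two sets.
    greedy : ∀ S Y {r J} n → r ≤ length Y → ∑ n J ≤ r →
             (∀ {i} → i ∈ J → n i ≤ count (S i) Y) → Selection S Y r J n
    greedy S [] {J = J} n z≤n _ h =
      record { chosen = [] ; rejected = [] ; split = ↭-refl ; size = refl ; enough = h }
    greedy S (y ∷ Y) {r} {J} n r≤ ∑n≤r h with any? (λ i → (1 ≤? n i) ×-dec (S i y ≟ᵇ true)) J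
    greedy S (y ∷ Y) {r} {J} n r≤ ∑n≤r h | yes needed
      with i , i∈ , n>0 , Siy ← find needed = take r r≤ ∑n≤r
      where
      n′ : K → ℕ
      n′ = lower (λ i → S i y) n
      n′i<ni : ∀ m b → 1 ≤ m → b ≡ true → m ∸ ⟦ b ⟧ < m
      n′i<ni (suc m) true _ _ = ≤-refl
      -- The demand of `i` is positive and `S i` contains `y`, so taking `y` lowers `∑ n` by at
      -- least as much as `r`.
      ∑n′<∑n : ∑ n′ J < ∑ n J
      ∑n′<∑n = ∑-mono-< J (λ {j} _ → m∸n≤m (n j) ⟦ S j y ⟧) i∈ (n′i<ni (n i) (S i y) n>0 Siy)
      take : ∀ r → r ≤ suc (length Y) → ∑ n J ≤ r → Selection S (y ∷ Y) r J n
      take zero _ ∑n≤0 = contradiction (≤-trans ∑n′<∑n ∑n≤0) λ ()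
      take (suc r) (s≤s r≤) ∑n≤r = record
        { chosen = y ∷ chosen ; rejected = rejected ; split = prep y split ; size = cong suc size
        ; enough = λ {j} j∈ → m∸n≤o⇒m≤n+o′ (n j) ⟦ S j y ⟧ (enough j∈) }
        where
        m∸n≤o⇒m≤n+o′ : ∀ m n {o} → m ∸ n ≤ o → m ≤ n + o
        m∸n≤o⇒m≤n+o′ m n h = ≤-trans (m≤n+m∸n m n) (+-monoʳ-≤ n h)
        open Selection (greedy S Y n′ r≤ (≤-pred (≤-trans ∑n′<∑n ∑n≤r))
                         (λ {j} j∈ → m≤n+o⇒m∸n≤o (n j) ⟦ S j y ⟧ (h j∈)))
    -- No set with a positive demand contains `y`, so rejecting it costs nothing, unless all
    -- remaining elements have to be chosen.
    greedy S (y ∷ Y) {r} {J} n r≤ ∑n≤r h | no unneeded with r ≟ℕ suc (length Y)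
    ... | yes r≡ = record
      { chosen = y ∷ Y ; rejected = [] ; split = ↭-sym (↭-++-identityʳ _) ; size = sym r≡ ; enough = h }
    ... | no r≢ = record
      { chosen = chosen ; rejected = y ∷ rejected
      ; split = ↭-trans (prep y split) (↭-sym (shift y chosen rejected))
      ; size = size ; enough = enough }
      where
      h′ : ∀ {i} → i ∈ J → n i ≤ count (S i) Y
      h′ {i} i∈ with n i in ni | S i y in Siy | h i∈
      ... | zero | _ | _ = z≤n
      ... | suc m | false | n≤ = n≤
      ... | suc m | true | _ = contradiction (lose i∈ (subst (1 ≤_) (sym ni) (s≤s z≤n) , Siy)) unneeded
      open Selection (greedy S Y n (≤-pred (≤∧≢⇒< r≤ r≢)) ∑n≤r h′)

    -- By bal, choosing at least n i elements of S i is the same as rejecting at least z i elements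
    -- outside S i, so exchanging chosen with rejected, S with its complement, n with z and r with q
    -- is a symmetry (flip-state, unflip).
    record State (S : K → C → Bool) (X : List C) (r q : ℕ) (J : List K) (n z : K → ℕ) : Set where
      field
        size   : length X ≡ r + q
        unique : Unique J
        n>0    : ∀ {i} → i ∈ J → 1 ≤ n i
        z>0    : ∀ {i} → i ∈ J → 1 ≤ z i
        n≤r    : ∀ {i} → i ∈ J → n i ≤ r
        z≤q    : ∀ {i} → i ∈ J → z i ≤ q
        bal    : ∀ {i} → i ∈ J → count (S i) X + z i ≡ n i + q
        pair   : ∀ {i j} → i ∈ J → j ∈ J → i ≢ j → n i + n j ≤ r + count (both S i j) X

      -- `S i` and its complement share the `r + q` elements of `X`, which turns `bal` into its
      -- mirror image.
      bal-not : ∀ {i} → i ∈ J → count (not ∘ S i) X + n i ≡ z i + r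
      bal-not {i} i∈ = +-cancelˡ-≡ (count (S i) X + q) _ _ (begin
        s + q + (s̄ + n i)         ≡⟨ e₁ s q s̄ (n i) ⟩
        s̄ + s + (n i + q)         ≡⟨ cong₂ _+_ (trans (count-not (S i) X) size) (sym (bal i∈)) ⟩
        r + q + (s + z i)         ≡⟨ e₂ r q s (z i) ⟩
        s + q + (z i + r)         ∎)
        where
        open ≡-Reasoning
        s = count (S i) X
        s̄ = count (not ∘ S i) X
        e₁ : ∀ s q t n → s + q + (t + n) ≡ t + s + (n + q)
        e₁ = solve-∀
        e₂ : ∀ r q s z → r + q + (s + z) ≡ s + q + (z + r)
        e₂ = solve-∀

      n≤count : ∀ {i} → i ∈ J → n i ≤ count (S i) X
      n≤count {i} i∈ = +-cancelʳ-≤ q _ _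
        (≤-trans (≤-reflexive (sym (bal i∈))) (+-monoʳ-≤ (count (S i) X) (z≤q i∈)))

      -- Inclusion-exclusion combined with `bal` for both sets. It makes the pair conditions for
      -- choosing and for rejecting the same inequality.
      pair-balance : ∀ {i j} → i ∈ J → j ∈ J →
        count (neither S i j) X + (n i + n j) + q ≡ r + count (both S i j) X + (z i + z j)
      pair-balance {i} {j} i∈ j∈ = +-cancelʳ-≡ q _ _ (begin
        o + (n i + n j) + q + q                 ≡⟨ e₁ o (n i) (n j) q ⟩
        o + ((n i + q) + (n j + q))             ≡⟨ cong (o +_) (cong₂ _+_ (bal i∈) (bal j∈)) ⟨
        o + ((s + z i) + (t + z j))             ≡⟨ e₂ o s (z i) t (z j) ⟩
        o + (s + t) + (z i + z j)               ≡⟨ cong (_+ (z i + z j)) (count-neither (S i) (S j) X) ⟩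
        length X + b + (z i + z j)              ≡⟨ cong (λ l → l + b + (z i + z j)) size ⟩
        r + q + b + (z i + z j)                 ≡⟨ e₃ r q b (z i + z j) ⟩
        r + b + (z i + z j) + q                 ∎)
        where
        open ≡-Reasoning
        o = count (neither S i j) X
        b = count (both S i j) X
        s = count (S i) X
        t = count (S j) X
        e₁ : ∀ o m n q → o + (m + n) + q + q ≡ o + ((m + q) + (n + q))
        e₁ = solve-∀
        e₂ : ∀ o s m t n → o + ((s + m) + (t + n)) ≡ o + (s + t) + (m + n)
        e₂ = solve-∀
        e₃ : ∀ r q b z → r + q + b + z ≡ r + b + z + q
        e₃ = solve-∀

      pair-neither : ∀ {i j} → i ∈ J → j ∈ J → i ≢ j → z i + z j ≤ q + count (neither S i j) X
      pair-neither {i} {j} i∈ j∈ i≢j = linear 0 (pair i∈ j∈ i≢j)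
        (transfer (z i + z j) (r + count (both S i j) X) q (count (neither S i j) X) (n i + n j)
                  (pair-balance i∈ j∈))
        where
        transfer : ∀ z b q o n → o + n + q ≡ b + z → z + b + 0 ≡ q + o + n
        transfer z b q o n eq = trans (e₁ z b) (trans (sym eq) (e₂ o n q))
          where
          e₁ : ∀ z b → z + b + 0 ≡ b + z
          e₁ = solve-∀
          e₂ : ∀ o n q → o + n + q ≡ q + o + n
          e₂ = solve-∀

    flip : (K → C → Bool) → K → C → Bool
    flip S i c = not (S i c)

    flip-state : ∀ {S X r q J n z} → State S X r q J n z → State (flip S) X q r J z n
    flip-state {r = r} {q} st = record
      { size = trans size (+-comm r q) ; unique = unique ; n>0 = z>0 ; z>0 = n>0
      ; n≤r = z≤q ; z≤q = n≤r ; bal = bal-not ; pair = pair-neither }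
      where open State st

    unflip : ∀ {S X r q J n z} → State S X r q J n z → Selection (flip S) X q J z → Selection S X r J n
    unflip {S} {X} {r} {q} {J} {n} {z} st sel = record
      { chosen = rejected ; rejected = chosen ; split = split′
      ; size = +-cancelˡ-≡ q _ _ (begin
          q + length rejected                ≡⟨ cong (_+ length rejected) size ⟨
          length chosen + length rejected    ≡⟨ length-++ chosen ⟨
          length (chosen ++ rejected)        ≡⟨ ↭-length split ⟨
          length X                           ≡⟨ State.size st ⟩
          r + q                              ≡⟨ +-comm r q ⟩
          q + r                              ∎)
      ; enough = λ {i} i∈ → bound (n i) (z i) _ _ _ (enough i∈)
          (trans (count-not (S i) chosen) size)
          (trans (cong (_+ z i) (trans (sym (∑-++ _ rejected)) (sym (∑-↭ _ split′)))) (State.bal st i∈)) }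
      where
      open Selection sel
      open ≡-Reasoning
      split′ : X ↭ rejected ++ chosen
      split′ = ↭-trans split (++-comm chosen rejected)
      -- `c` and `c̄` count the elements now rejected inside and outside `S i`, and `d` those now
      -- chosen inside. By `bal`, at least `z` rejections outside mean at least `n` choices inside.
      bound : ∀ n z c c̄ d → z ≤ c̄ → c̄ + c ≡ q → d + c + z ≡ n + q → n ≤ d
      bound n z c c̄ d z≤ refl eq = linear 0 z≤ (trans (+-identityʳ (n + c̄)) (sym eq′))
        where
        eq′ : d + z ≡ n + c̄
        eq′ = +-cancelʳ-≡ c _ _ (trans (e₃ d z c) (trans eq (e₄ n c̄ c)))
          where
          e₃ : ∀ d z c → d + z + c ≡ d + c + z
          e₃ = solve-∀
          e₄ : ∀ n b c → n + (b + c) ≡ n + b + c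
          e₄ = solve-∀

    -- Choosing `x` uses up one choice. This is safe if each single demand still fits and each pair
    -- of sets that both miss `x` has slack one.
    module Step {S X r q J n z x X′} (st : State S X (suc r) q J n z) (X↭ : X ↭ x ∷ X′)
      (n<r : ∀ {i} → i ∈ J → n i < suc r)
      (loose : ∀ {i j} → i ∈ J → j ∈ J → i ≢ j → S i x ≡ false → S j x ≡ false →
               n i + n j < suc r + count (both S i j) X) where

      open State st

      n′ : K → ℕ
      n′ = lower (λ i → S i x) n

      -- Satisfied demands are dropped, because a `State` has positive ones only.
      J′ : List K
      J′ = filter (λ i → 1 ≤? n′ i) J

      J′⊆J : ∀ {i} → i ∈ J′ → i ∈ J
      J′⊆J i∈ = proj₁ (∈-filter⁻ (λ i → 1 ≤? n′ i) {xs = J} i∈)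

      count-X : ∀ p → count p X ≡ ⟦ p x ⟧ + count p X′
      count-X p = ∑-↭ _ X↭

      state : State S X′ r q J′ n′ z
      state = record
        { size = suc-injective (trans (sym (↭-length X↭)) size)
        ; unique = Unique.filter⁺ _ unique
        ; n>0 = λ i∈ → proj₂ (∈-filter⁻ (λ i → 1 ≤? n′ i) {xs = J} i∈)
        ; z>0 = z>0 ∘ J′⊆J
        ; n≤r = λ {i} i∈ → n′≤r (n i) (S i x) (n<r (J′⊆J i∈))
        ; z≤q = z≤q ∘ J′⊆J
        ; bal = λ {i} i∈ → bal′ (n i) (S i x) (count (S i) X′) (n>0 (J′⊆J i∈))
            (trans (cong (_+ z i) (sym (count-X (S i)))) (bal (J′⊆J i∈)))
        ; pair = λ {i} {j} i∈ j∈ i≢j → pair′ (n i) (n j) (S i x) (S j x) (count (both S i j) X′)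
            (n>0 (J′⊆J i∈)) (n>0 (J′⊆J j∈))
            (subst (λ c → n i + n j ≤ suc r + c) (count-X _) (pair (J′⊆J i∈) (J′⊆J j∈) i≢j))
            (λ Sx Sx′ → subst (λ c → n i + n j < suc r + c) (count-X _)
                          (loose (J′⊆J i∈) (J′⊆J j∈) i≢j Sx Sx′)) }
        where
        n′≤r : ∀ m b → m < suc r → m ∸ ⟦ b ⟧ ≤ r
        n′≤r m b m<r = ≤-trans (m∸n≤m m ⟦ b ⟧) (≤-pred m<r)
        bal′ : ∀ m b c {z} → 1 ≤ m → ⟦ b ⟧ + c + z ≡ m + q → c + z ≡ m ∸ ⟦ b ⟧ + q
        bal′ (suc m) true c _ eq = suc-injective eq
        bal′ (suc m) false c _ eq = eq
        -- If `x` lies in both sets, both sides drop by two; if in one, by one. If it lies in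
        -- neither, only the right side drops, and the strict bound pays for it.
        pair′ : ∀ l m b c o → 1 ≤ l → 1 ≤ m → l + m ≤ suc r + (⟦ b ∧ c ⟧ + o) →
                (b ≡ false → c ≡ false → l + m < suc r + (⟦ b ∧ c ⟧ + o)) →
                l ∸ ⟦ b ⟧ + (m ∸ ⟦ c ⟧) ≤ r + o
        pair′ (suc l) (suc m) true true o _ _ h _ =
          ≤-pred (≤-pred (subst₂ _≤_ (cong suc (+-suc l m)) (cong suc (+-suc r o)) h))
        pair′ (suc l) (suc m) true false o _ _ h _ = ≤-pred h
        pair′ (suc l) (suc m) false true o _ _ h _ = ≤-pred (subst (_≤ suc r + o) (cong suc (+-suc l m)) h)
        pair′ l m false false o _ _ _ h = ≤-pred (h refl refl)

      extend : Selection S X′ r J′ n′ → Selection S X (suc r) J n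
      extend sel = record
        { chosen = x ∷ chosen ; rejected = rejected ; split = ↭-trans X↭ (prep x split)
        ; size = cong suc size′ ; enough = enough′ }
        where
        open Selection sel renaming (size to size′)
        enough′ : ∀ {i} → i ∈ J → n i ≤ count (S i) (x ∷ chosen)
        enough′ {i} i∈ with 1 ≤? n′ i
        ... | yes n′>0 = ≤-trans (m≤n+m∸n (n i) ⟦ S i x ⟧)
                           (+-monoʳ-≤ ⟦ S i x ⟧ (enough (∈-filter⁺ (λ i → 1 ≤? n′ i) i∈ n′>0)))
        ... | no n′≯0 = ≤-trans (m≤n+m∸n (n i) ⟦ S i x ⟧)
                           (+-monoʳ-≤ ⟦ S i x ⟧ (≤-trans (≤-pred (≰⇒> n′≯0)) z≤n))

      ∑-n′ : ∑ n′ J′ + count (λ i → S i x) J ≤ ∑ n J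
      ∑-n′ = ≤-trans (+-monoˡ-≤ _ (∑-filter-≤ n′ (λ i → 1 ≤? n′ i) J))
        (≤-reflexive (trans (sym (∑-+ n′ (λ i → ⟦ S i x ⟧) J))
          (∑-cong J λ {i} i∈ → restore (n i) (S i x) (n>0 i∈))))
        where
        restore : ∀ m b → 1 ≤ m → m ∸ ⟦ b ⟧ + ⟦ b ⟧ ≡ m
        restore (suc m) true _ = +-comm m 1
        restore (suc m) false _ = +-identityʳ (suc m)

      ∑-J′ : ∀ f → ∑ f J′ ≤ ∑ f J
      ∑-J′ f = ∑-filter-≤ f (λ i → 1 ≤? n′ i) J

    -- Selection under balanced demands

    filter-split : ∀ (p : C → Bool) X → ∃ λ Y → X ↭ filter (λ c → p c ≟ᵇ true) X ++ Y
    filter-split p [] = [] , ↭-refl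
    filter-split p (x ∷ X) with Y , s ← filter-split p X | p x ≟ᵇ true
    ... | yes _ = Y , prep x s
    ... | no _ = x ∷ Y , ↭-trans (prep x s) (↭-sym (shift x _ Y))

    count-filter : ∀ (p s : C → Bool) X →
      count s (filter (λ c → p c ≟ᵇ true) X) ≡ count (λ c → p c ∧ s c) X
    count-filter p s [] = refl
    count-filter p s (x ∷ X) with p x
    ... | true = cong (⟦ s x ⟧ +_) (count-filter p s X)
    ... | false = count-filter p s X

    length-filter : ∀ (p : C → Bool) X → length (filter (λ c → p c ≟ᵇ true) X) ≡ count p X
    length-filter p [] = refl
    length-filter p (x ∷ X) with p x
    ... | true = cong suc (length-filter p X)
    ... | false = length-filter p X

    pair-≤∑ : ∀ f {i j} {J : List K} → i ∈ J → j ∈ J → i ≢ j → f i + f j ≤ ∑ f J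
    pair-≤∑ f {i} {j} {J} i∈ j∈ i≢j =
      subst (λ m → f i + m ≤ ∑ f J) (+-identityʳ (f j))
        (∑-⊆ f {i ∷ j ∷ []} ((i≢j ∷ []) ∷ [] ∷ []) λ { (here refl) → i∈ ; (there (here refl)) → j∈ })

    -- All choices must be made inside S i, and the other demands add up to at most r.
    saturated : ∀ {S X r q J n z i} → State S X r q J n z → i ∈ J → n i ≡ r → ∑ n J ≤ 2 * r →
                Selection S X r J n
    saturated {S} {X} {r} {q} {J} {n} {z} {i} st i∈ ni≡r ∑n≤2r = record
      { chosen = chosen ; rejected = rejected ++ N
      ; split = ↭-trans X↭ (↭-trans (++⁺ʳ N split) (++-assoc chosen rejected N))
      ; size = sel-size
      ; enough = enough′ }
      where
      open State st
      Y = filter (λ c → S i c ≟ᵇ true) X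
      N = proj₁ (filter-split (S i) X)
      X↭ = proj₂ (filter-split (S i) X)
      J₁ = filter (λ j → ¬? (i ≟ j)) J
      ∑-J₁ : n i + ∑ n J₁ ≤ ∑ n J
      ∑-J₁ = ∑-⊆ n {i ∷ J₁}
        (All.tabulate (λ j∈ → proj₂ (∈-filter⁻ (λ j → ¬? (i ≟ j)) {xs = J} j∈)) ∷ Unique.filter⁺ _ unique)
        λ { (here refl) → i∈ ; (there j∈) → proj₁ (∈-filter⁻ (λ j → ¬? (i ≟ j)) {xs = J} j∈) }
      ∑-J₁≤r : ∑ n J₁ ≤ r
      ∑-J₁≤r = +-cancelˡ-≤ r _ _ (≤-trans (subst (λ m → m + ∑ n J₁ ≤ ∑ n J) ni≡r ∑-J₁)
        (≤-trans ∑n≤2r (≤-reflexive (cong (r +_) (+-identityʳ r)))))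
      r≤Y : r ≤ length Y
      r≤Y = ≤-trans (≤-trans (≤-reflexive (sym ni≡r)) (n≤count i∈)) (≤-reflexive (sym (length-filter (S i) X)))
      -- As `n i` equals `r`, the pair condition of `i` and `j` leaves at least `n j` elements in
      -- `S i` ∩ `S j`.
      available : ∀ {j} → j ∈ J₁ → n j ≤ count (S j) Y
      available {j} j∈₁ with j∈ , i≢j ← ∈-filter⁻ (λ j → ¬? (i ≟ j)) {xs = J} j∈₁ =
        ≤-trans (+-cancelˡ-≤ r _ _ (subst (λ m → m + n j ≤ _) ni≡r (pair i∈ j∈ i≢j)))
          (≤-reflexive (sym (count-filter (S i) (S j) X)))
      open Selection (greedy S Y n r≤Y ∑-J₁≤r available) renaming (size to sel-size)
      chosen-in : ∀ {c} → c ∈ chosen → S i c ≡ true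
      chosen-in c∈ = proj₂ (∈-filter⁻ (λ c → S i c ≟ᵇ true) {xs = X}
        (∈-resp-↭ (↭-sym split) (∈-++⁺ˡ c∈)))
      enough′ : ∀ {j} → j ∈ J → n j ≤ count (S j) chosen
      enough′ {j} j∈ with i ≟ j
      ... | no i≢j = enough (∈-filter⁺ (λ j → ¬? (i ≟ j)) j∈ i≢j)
      ... | yes refl = ≤-reflexive (trans ni≡r (trans (sym sel-size) (trans (sym (∑-1 chosen))
              (∑-cong chosen λ c∈ → cong ⟦_⟧ (sym (chosen-in c∈))))))

    select-disjoint : ∀ {S X r q J n z} → State S X r q J n z → ∑ n J ≤ r → Selection S X r J n
    select-disjoint {S} {X} {r} {q} {n = n} st ∑n≤r =
      greedy S X n (≤-trans (m≤m+n r q) (≤-reflexive (sym size))) ∑n≤r n≤count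
      where open State st

    -- Choosing x would violate the pair condition of i and j.
    record TightOutside (S : K → C → Bool) (X : List C) (r : ℕ) (J : List K) (n : K → ℕ) (x : C) : Set where
      constructor tightOutside
      field
        {i j} : K
        i∈    : i ∈ J
        j∈    : j ∈ J
        i≢j   : i ≢ j
        x∉i   : S i x ≡ false
        x∉j   : S j x ≡ false
        tight : r + count (both S i j) X ≤ n i + n j

    tightOutside? : ∀ S X r J n x → Dec (TightOutside S X r J n x)
    tightOutside? S X r J n x with any? (λ i → any? (λ j → ¬? (i ≟ j) ×-dec (S i x ≟ᵇ false) ×-dec
           (S j x ≟ᵇ false) ×-dec (r + count (both S i j) X ≤? n i + n j)) J) J
    ... | yes p with i , i∈ , p ← find p with j , j∈ , i≢j , x∉i , x∉j , t ← find p =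
      yes (tightOutside i∈ j∈ i≢j x∉i x∉j t)
    ... | no ¬p = no λ { (tightOutside i∈ j∈ i≢j x∉i x∉j t) → ¬p (lose i∈ (lose j∈ (i≢j , x∉i , x∉j , t))) }

    four-≤∑ : ∀ (f : K → ℕ) {g h i j} {J : List K} → g ∈ J → h ∈ J → i ∈ J → j ∈ J →
      g ≢ h → i ≢ j → g ≢ i → g ≢ j → h ≢ i → h ≢ j → (f g + f h) + (f i + f j) ≤ ∑ f J
    four-≤∑ f {g} {h} {i} {j} {J} g∈ h∈ i∈ j∈ g≢h i≢j g≢i g≢j h≢i h≢j =
      subst (_≤ ∑ f J) (assoc (f g) (f h) (f i) (f j))
        (∑-⊆ f {g ∷ h ∷ i ∷ j ∷ []}
          ((g≢h ∷ g≢i ∷ g≢j ∷ []) ∷ (h≢i ∷ h≢j ∷ []) ∷ (i≢j ∷ []) ∷ [] ∷ [])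
          λ { (here refl) → g∈ ; (there (here refl)) → h∈ ; (there (there (here refl))) → i∈
            ; (there (there (there (here refl)))) → j∈ })
      where
      assoc : ∀ a b c d → a + (b + (c + (d + 0))) ≡ a + b + (c + d)
      assoc = solve-∀

    three-≤∑ : ∀ (f : K → ℕ) {h i j} {J : List K} → h ∈ J → i ∈ J → j ∈ J →
      h ≢ i → h ≢ j → i ≢ j → f h + (f i + f j) ≤ ∑ f J
    three-≤∑ f {h} {i} {j} {J} h∈ i∈ j∈ h≢i h≢j i≢j =
      subst (λ m → f h + (f i + m) ≤ ∑ f J) (+-identityʳ (f j))
        (∑-⊆ f {h ∷ i ∷ j ∷ []} ((h≢i ∷ h≢j ∷ []) ∷ (i≢j ∷ []) ∷ [] ∷ [])
          λ { (here refl) → h∈ ; (there (here refl)) → i∈ ; (there (there (here refl))) → j∈ })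

    separated : ∀ (p : K → Bool) {i j} → p i ≡ true → p j ≡ false → i ≢ j
    separated p pi pj refl with () ← trans (sym pi) pj

    pair-count : ∀ {i j} {J : List K} (p : K → Bool) → i ∈ J → j ∈ J → i ≢ j →
                 p i ≡ true → p j ≡ true → 2 ≤ count p J
    pair-count p i∈ j∈ i≢j pi pj =
      ≤-trans (≤-reflexive (cong₂ (λ b c → ⟦ b ⟧ + ⟦ c ⟧) (sym pi) (sym pj)))
              (pair-≤∑ (λ i → ⟦ p i ⟧) i∈ j∈ i≢j)

    not-false : ∀ {b} → not b ≡ false → b ≡ true
    not-false {true} _ = refl

    -- The demands of the two tight pairs would add up to more than 2r.
    no-conflict : ∀ {S X r q J n z x} → State S X r q J n z → ∑ n J ≤ 2 * r → x ∈ X →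
      TightOutside S X r J n x → ¬ TightOutside (flip S) X q J z x
    no-conflict {S} {X} {r} {q} {J} {n} {z} {x} st ∑n≤2r x∈ (tightOutside {i} {j} i∈ j∈ i≢j x∉i x∉j t)
      (tightOutside {g} {h} g∈ h∈ g≢h x∈g x∈h t′) =
      <-irrefl refl (begin-strict
        2 * r                                  ≡⟨ cong (r +_) (+-identityʳ r) ⟩
        r + r                                  <⟨ +-mono-<-≤ r<gh (≤-trans (m≤m+n r _) t) ⟩
        (n g + n h) + (n i + n j)              ≤⟨ four-≤∑ n g∈ h∈ i∈ j∈ g≢h i≢j (apart (not-false x∈g) x∉i)
                                                    (apart (not-false x∈g) x∉j) (apart (not-false x∈h) x∉i) (apart (not-false x∈h) x∉j) ⟩
        ∑ n J                                  ≤⟨ ∑n≤2r ⟩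
        2 * r                                  ∎)
      where
      open State st
      open ≤-Reasoning
      -- `x` lies in `S g` and `S h` but in neither `S i` nor `S j`, so the four indices are
      -- distinct.
      apart = separated (λ i → S i x)
      b = count (both S g h) X
      transfer : ∀ b m q o z r → o + m + q ≡ r + b + z → r + b + z + 0 ≡ m + (q + o)
      transfer b m q o z r eq = trans (+-identityʳ _) (trans (sym eq) (e o m q))
        where
        e : ∀ o m q → o + m + q ≡ m + (q + o)
        e = solve-∀
      -- `pair-balance` turns tightness for rejecting into tightness for choosing. Since `x` lies in
      -- `S g` ∩ `S h`, `b` is positive and `n g + n h` exceeds `r`.
      r+b≤gh : r + b ≤ n g + n h
      r+b≤gh = linear 0 t′ (transfer b (n g + n h) q (count (neither S g h) X) (z g + z h) r (pair-balance g∈ h∈))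
      r<gh : r < n g + n h
      r<gh = ≤-trans (≤-trans (≤-reflexive (+-comm 1 r)) (+-monoʳ-≤ r (∃⇒count>0 (both S g h) x∈
        (cong₂ _∧_ (not-false x∈g) (not-false x∈h))))) r+b≤gh

    -- Quantified over all states on `X`, so that the induction hypothesis also serves flipped
    -- states.
    BalancedAt : List C → Set
    BalancedAt X = ∀ {S r q J n z} → State S X r q J n z → ∑ n J ≤ 2 * r → ∑ z J ≤ 2 * q → Selection S X r J n

    -- The bound `2 * r` drops by two. Two sets containing `x` lower `∑ n` by as much; with at most
    -- two sets, the new bound holds because no demand exceeds the choices that remain.
    choose : ∀ {X X′ x} → X ↭ x ∷ X′ → BalancedAt X′ → ∀ {S r q J n z} → State S X r q J n z → 0 < r →
      (∀ {i} → i ∈ J → n i < r) → ¬ TightOutside S X r J n x →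
      2 ≤ count (λ i → S i x) J ⊎ length J ≤ 2 → ∑ n J ≤ 2 * r → ∑ z J ≤ 2 * q → Selection S X r J n
    choose {X} {X′} {x} X↭ select-X′ {S} {suc r} {q} {J} {n} {z} st _ n<r loose two ∑n≤2r ∑z≤2q =
      extend (select-X′ state (sum-bound two) (≤-trans (∑-J′ z) ∑z≤2q))
      where
      open Step st X↭ n<r (λ i∈ j∈ i≢j x∉i x∉j → ≰⇒> λ t → loose (tightOutside i∈ j∈ i≢j x∉i x∉j t))
      2r : 2 * suc r ≡ 2 * r + 2
      2r = e r where
        e : ∀ r → 2 * suc r ≡ 2 * r + 2
        e = solve-∀
      sum-bound : 2 ≤ count (λ i → S i x) J ⊎ length J ≤ 2 → ∑ n′ J′ ≤ 2 * r
      sum-bound (inj₁ 2≤) = +-cancelʳ-≤ 2 _ _ (≤-trans (+-monoʳ-≤ (∑ n′ J′) 2≤)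
        (≤-trans ∑-n′ (≤-trans ∑n≤2r (≤-reflexive 2r))))
      sum-bound (inj₂ ≤2) = ≤-trans (∑-J′ n′) (≤-trans (∑-≤-* J λ {i} i∈ →
        ≤-trans (m∸n≤m (n i) ⟦ S i x ⟧) (≤-pred (n<r i∈))) (*-monoˡ-≤ r ≤2))

    ∑>0⇒∃ : ∀ (f : K → ℕ) J → 0 < ∑ f J → ∃ λ i → i ∈ J
    ∑>0⇒∃ f (i ∷ J) _ = i , here refl

    -- Induction on `X`. Outside the easy cases the head is chosen or rejected: a tight pair that
    -- forbids one option consists of two sets served by the other, and `no-conflict` excludes that
    -- both options are forbidden.
    select-balanced : ∀ X → BalancedAt X
    select-balanced [] {r = r} st ∑n≤2r _ = select-disjoint st (≤-trans ∑n≤2r (≤-trans (≤-reflexive (cong (2 *_) r≡0)) z≤n))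
      where
      r≡0 : r ≡ 0
      r≡0 = m+n≡0⇒m≡0 r (sym (State.size st))
    select-balanced (x ∷ X) {S} {r} {q} {J} {n} {z} st ∑n≤2r ∑z≤2q
      with ∑ n J ≤? r | any? (λ i → n i ≟ℕ r) J | any? (λ i → z i ≟ℕ q) J
    ... | yes ∑n≤r | _ | _ = select-disjoint st ∑n≤r
    ... | no _ | yes p | _ with i , i∈ , ni≡r ← find p = saturated st i∈ ni≡r ∑n≤2r
    ... | no _ | no _ | yes p with i , i∈ , zi≡q ← find p =
      unflip st (saturated (flip-state st) i∈ zi≡q ∑z≤2q)
    ... | no ∑n≰r | no n≢r | no z≢q =
      cases (tightOutside? S (x ∷ X) r J n x) (tightOutside? (flip S) (x ∷ X) q J z x)
      where
      open State st
      n<r : ∀ {i} → i ∈ J → n i < r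
      n<r i∈ = ≤∧≢⇒< (n≤r i∈) λ eq → n≢r (lose i∈ eq)
      z<q : ∀ {i} → i ∈ J → z i < q
      z<q i∈ = ≤∧≢⇒< (z≤q i∈) λ eq → z≢q (lose i∈ eq)
      -- `∑ n J` exceeds `r`, so there is a demand, and its strict bounds show that neither `r` nor
      -- `q` is 0.
      key = ∑>0⇒∃ n J (≤-trans (s≤s z≤n) (≰⇒> ∑n≰r))
      In = count (λ i → S i x) J
      Out = count (λ i → not (S i x)) J
      put-1 : ¬ TightOutside S (x ∷ X) r J n x → 2 ≤ In ⊎ length J ≤ 2 → Selection S (x ∷ X) r J n
      put-1 loose two = choose ↭-refl (select-balanced X) st (≤-trans (s≤s z≤n) (n<r (proj₂ key))) n<r loose two ∑n≤2r ∑z≤2q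
      put-0 : ¬ TightOutside (flip S) (x ∷ X) q J z x → 2 ≤ Out → Selection S (x ∷ X) r J n
      put-0 loose two = unflip st (choose ↭-refl (select-balanced X) (flip-state st)
        (≤-trans (s≤s z≤n) (z<q (proj₂ key))) z<q loose (inj₁ two) ∑z≤2q ∑n≤2r)
      cases : Dec (TightOutside S (x ∷ X) r J n x) → Dec (TightOutside (flip S) (x ∷ X) q J z x) →
              Selection S (x ∷ X) r J n
      cases (yes t@(tightOutside i∈ j∈ i≢j x∉i x∉j _)) _ =
        put-0 (no-conflict st ∑n≤2r (here refl) t)
          (pair-count (λ i → not (S i x)) i∈ j∈ i≢j (cong not x∉i) (cong not x∉j))
      cases (no ¬t) (yes (tightOutside i∈ j∈ i≢j x∈i x∈j _)) =
        put-1 ¬t (inj₁ (pair-count (λ i → S i x) i∈ j∈ i≢j (not-false x∈i) (not-false x∈j)))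
      cases (no ¬t) (no ¬t′) with 2 ≤? In | 2 ≤? Out
      ... | yes two | _ = put-1 ¬t (inj₁ two)
      ... | no _ | yes two = put-0 ¬t′ two
      -- At most one set contains `x` and at most one misses it, so there are at most two sets.
      ... | no In≱2 | no Out≱2 = put-1 ¬t (inj₂ (≤-trans (≤-reflexive (sym (count-not (λ i → S i x) J)))
              (+-mono-≤ (≤-pred (≰⇒> Out≱2)) (≤-pred (≰⇒> In≱2)))))

    -- Selection when the demands on rejections are too large

    record Tight (S : K → C → Bool) (X : List C) (r : ℕ) (J : List K) (n : K → ℕ) (i j : K) : Set where
      constructor tight-pair
      field
        i∈    : i ∈ J
        j∈    : j ∈ J
        i≢j   : i ≢ j
        -- Together with `pair` this is an equality: a selection must then contain all of `S i` ∩
        -- `S j` and nothing outside `S i` ∪ `S j`.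
        tight : r + count (both S i j) X ≤ n i + n j

    both-comm : ∀ S i j X → count (both S i j) X ≡ count (both S j i) X
    both-comm S i j X = ∑-cong X λ {c} _ → cong ⟦_⟧ (∧-comm (S i c) (S j c))

    Tight-sym : ∀ {S X r J n i j} → Tight S X r J n i j → Tight S X r J n j i
    Tight-sym {S} {X} {r} {J} {n} {i} {j} (tight-pair i∈ j∈ i≢j t) =
      tight-pair j∈ i∈ (i≢j ∘ sym) (subst₂ (λ b m → r + b ≤ m) (both-comm S i j X) (+-comm (n i) (n j)) t)

    -- Applied while `∑ z` exceeds `2 * q`, which forces `∑ n` below `2 * r`. The two bounds make
    -- tight pairs rare.
    module Crowded {S X r q J n z} (st : State S X r q J n z)
      (∑n<2r : ∑ n J < 2 * r) (∑z-bound : ∑ (λ i → 2 * z i ∸ 1) J + 3 ≤ 4 * q) where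

      open State st

      -- The demands of a tight pair add up to at least `r`, and all demands together stay below
      -- `2 * r`.
      no-disjoint-pairs : ∀ {g h i j} → Tight S X r J n g h → Tight S X r J n i j →
        ¬ (g ≢ i × g ≢ j × h ≢ i × h ≢ j)
      no-disjoint-pairs {g} {h} {i} {j} (tight-pair g∈ h∈ g≢h t) (tight-pair i∈ j∈ i≢j t′)
        (g≢i , g≢j , h≢i , h≢j) = <⇒≱ ∑n<2r (begin
          2 * r                     ≡⟨ cong (r +_) (+-identityʳ r) ⟩
          r + r                     ≤⟨ +-mono-≤ (≤-trans (m≤m+n r _) t) (≤-trans (m≤m+n r _) t′) ⟩
          n g + n h + (n i + n j)   ≤⟨ four-≤∑ n g∈ h∈ i∈ j∈ g≢h i≢j g≢i g≢j h≢i h≢j ⟩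
          ∑ n J                     ∎)
        where open ≤-Reasoning

      -- Three disjoint sets do not fit into X.
      no-disjoint-triple : ∀ {h i j} → h ∈ J → Tight S X r J n i j → h ≢ i → h ≢ j →
        ¬ (count (both S h i) X ≡ 0 × count (both S i j) X ≡ 0 × count (both S h j) X ≡ 0)
      no-disjoint-triple {h} {i} {j} h∈ (tight-pair i∈ j∈ i≢j t) h≢i h≢j (hi , ij , hj) =
        <-irrefl refl (arith (count (S h) X) (count (S i) X) (count (S j) X) (n h) (n i) (n j) (z h) (z i) (z j)
          sets (bal h∈) (bal i∈) (bal j∈) (≤-trans (m≤m+n r _) t) (n>0 h∈) triple)
        where
        sets : count (S h) X + (count (S i) X + count (S j) X) ≤ r + q
        sets = subst (count (S h) X + (count (S i) X + count (S j) X) ≤_) (+-identityʳ (r + q))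
          (subst₂ (λ l o → count (S h) X + (count (S i) X + count (S j) X) ≤ l + o) size
            (cong₂ _+_ hi (cong₂ _+_ ij hj)) (count-three (S h) (S i) (S j) X))
        double : ∀ m → 2 * m ≤ 2 * m ∸ 1 + 1
        double m = ≤-trans (m≤n+m∸n (2 * m) 1) (≤-reflexive (+-comm 1 (2 * m ∸ 1)))
        -- Each of the three summands of `∑z-bound` falls short of `2 * z` by at most 1; the 3 in
        -- that bound compensates.
        triple : 2 * (z h + (z i + z j)) ≤ 4 * q
        triple = begin
          2 * (z h + (z i + z j))                 ≡⟨ e₁ (z h) (z i) (z j) ⟩
          2 * z h + (2 * z i + 2 * z j)           ≤⟨ +-mono-≤ (double (z h)) (+-mono-≤ (double (z i)) (double (z j))) ⟩
          f h + 1 + (f i + 1 + (f j + 1))         ≡⟨ e₂ (f h) (f i) (f j) ⟩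
          f h + (f i + f j) + 3                   ≤⟨ +-monoˡ-≤ 3 (three-≤∑ f h∈ i∈ j∈ h≢i h≢j i≢j) ⟩
          ∑ f J + 3                               ≤⟨ ∑z-bound ⟩
          4 * q                                   ∎
          where
          open ≤-Reasoning
          f : K → ℕ
          f i = 2 * z i ∸ 1
          e₁ : ∀ a b c → 2 * (a + (b + c)) ≡ 2 * a + (2 * b + 2 * c)
          e₁ = solve-∀
          e₂ : ∀ a b c → a + 1 + (b + 1 + (c + 1)) ≡ a + (b + c) + 3
          e₂ = solve-∀
        arith : ∀ s t u a b c x y w → s + (t + u) ≤ r + q → s + x ≡ a + q → t + y ≡ b + q → u + w ≡ c + q →
                r ≤ b + c → 1 ≤ a → 2 * (x + (y + w)) ≤ 4 * q → 4 * q < 4 * q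
        arith s t u a b c x y w stu≤ sx ty uw r≤ a>0 xyw≤ =
          linear 1 (≤-trans (*-monoʳ-≤ 2 large) xyw≤) (e₅ q)
          where
          open ≤-Reasoning
          e₂ : ∀ a b c q → a + (b + c) + 3 * q ≡ (a + q) + ((b + q) + (c + q))
          e₂ = solve-∀
          e₃ : ∀ s t u x y w → (s + x) + ((t + y) + (u + w)) ≡ s + (t + u) + (x + (y + w))
          e₃ = solve-∀
          e₄ : ∀ r q Z → suc (2 * q) + (r + q + Z) + 0 ≡ Z + (1 + r + 3 * q)
          e₄ = solve-∀
          e₅ : ∀ q → suc (4 * q) + 4 * q + 1 ≡ 4 * q + 2 * suc (2 * q)
          e₅ = solve-∀
          -- The sets have at most `r + q` elements together, but demands of at least `r + 1`; by
          -- `bal`, the required rejections outside them add up to more than `2 * q`.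
          large : suc (2 * q) ≤ x + (y + w)
          large = linear 0 (begin
            1 + r + 3 * q                         ≤⟨ +-monoˡ-≤ (3 * q) (+-mono-≤ a>0 r≤) ⟩
            a + (b + c) + 3 * q                   ≡⟨ e₂ a b c q ⟩
            (a + q) + ((b + q) + (c + q))         ≡⟨ cong₂ _+_ sx (cong₂ _+_ ty uw) ⟨
            (s + x) + ((t + y) + (u + w))         ≡⟨ e₃ s t u x y w ⟩
            s + (t + u) + (x + (y + w))           ≤⟨ +-monoˡ-≤ (x + (y + w)) stu≤ ⟩
            r + q + (x + (y + w))                 ∎) (e₄ r q (x + (y + w)))

      -- `S i` contains `x`, so `i` is not in the pair that blocks `x`. Two tight pairs share an
      -- index, so `j` is in it, and `m` is its partner.
      escape : ∀ {i j x} → Tight S X r J n i j → S i x ≡ true → TightOutside S X r J n x →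
               ∃ λ m → m ≢ i × m ≢ j × Tight S X r J n j m
      escape {i} {j} {x} tij x∈i (tightOutside {g} {h} g∈ h∈ g≢h x∉g x∉h t) = cases (j ≟ g) (j ≟ h)
        where
        tgh : Tight S X r J n g h
        tgh = tight-pair g∈ h∈ g≢h t
        i≢ : ∀ {l} → S l x ≡ false → i ≢ l
        i≢ = separated (λ i → S i x) x∈i
        cases : Dec (j ≡ g) → Dec (j ≡ h) → ∃ λ m → m ≢ i × m ≢ j × Tight S X r J n j m
        cases (yes refl) _ = h , i≢ x∉h ∘ sym , g≢h ∘ sym , tgh
        cases (no _) (yes refl) = g , i≢ x∉g ∘ sym , g≢h , Tight-sym tgh
        cases (no j≢g) (no j≢h) =
          contradiction (i≢ x∉g , i≢ x∉h , j≢g , j≢h) (no-disjoint-pairs tij tgh)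

      free-element : 0 < length X → ∃ λ x → x ∈ X × ¬ TightOutside S X r J n x
      free-element X>0 with any? (λ i → any? (λ j → ¬? (i ≟ j) ×-dec (r + count (both S i j) X ≤? n i + n j)
                               ×-dec (1 ≤? count (both S i j) X)) J) J
      -- Here `x` lies in both sets of a tight pair. A tight pair that misses `x` would have no
      -- index in common with it.
      ... | yes p with i , i∈ , p ← find p with j , j∈ , i≢j , t , c>0 ← find p
                  with x , x∈ , x∈ij ← count>0⇒∃ (both S i j) X c>0 = x , x∈ , λ
        { (tightOutside {g} {h} g∈ h∈ g≢h x∉g x∉h t′) →
            no-disjoint-pairs (tight-pair i∈ j∈ i≢j t) (tight-pair g∈ h∈ g≢h t′)
              ( differ (∧-true₁ x∈ij) x∉g , differ (∧-true₁ x∈ij) x∉h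
              , differ (∧-true₂ x∈ij) x∉g , differ (∧-true₂ x∈ij) x∉h ) }
        where
        differ : ∀ {i g x} → S i x ≡ true → S g x ≡ false → i ≢ g
        differ {x = x} = separated (λ i → S i x)
        ∧-true₁ : ∀ {a b} → a ∧ b ≡ true → a ≡ true
        ∧-true₁ {true} _ = refl
        ∧-true₂ : ∀ {a b} → a ∧ b ≡ true → b ≡ true
        ∧-true₂ {true} eq = eq
      -- From here on the two sets of any tight pair are disjoint. If there is no tight pair, every
      -- element will do.
      ... | no ¬meeting with any? (λ i → any? (λ j → ¬? (i ≟ j) ×-dec (r + count (both S i j) X ≤? n i + n j)) J) J
      ...   | no ¬tight = first X X>0
        where
        first : ∀ Y → 0 < length Y → ∃ λ x → x ∈ Y × ¬ TightOutside S X r J n x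
        first (x ∷ _) _ = x , here refl , λ { (tightOutside i∈ j∈ i≢j _ _ t) → ¬tight (lose i∈ (lose j∈ (i≢j , t))) }
      -- Otherwise one element from each set of a tight pair is tried.
      ...   | yes p with i , i∈ , p ← find p with j , j∈ , i≢j , t ← find p
          with x , x∈ , x∈i ← count>0⇒∃ (S i) X (≤-trans (n>0 i∈) (n≤count i∈))
          with y , y∈ , y∈j ← count>0⇒∃ (S j) X (≤-trans (n>0 j∈) (n≤count j∈))
          with tightOutside? S X r J n x | tightOutside? S X r J n y
      ...     | no ¬b | _ = x , x∈ , ¬b
      ...     | yes _ | no ¬b = y , y∈ , ¬b
      -- If both are blocked, `j` and `i` have further tight partners `m` and `l`. Different
      -- partners give two tight pairs without a common index; equal ones give three pairwise
      -- disjoint sets.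
      ...     | yes bx | yes by
          with m , m≢i , m≢j , tjm ← escape (tight-pair i∈ j∈ i≢j t) x∈i bx
          with l , l≢j , l≢i , til ← escape (Tight-sym (tight-pair i∈ j∈ i≢j t)) y∈j by
          with m ≟ l
      ...       | no m≢l = contradiction (i≢j ∘ sym , l≢j ∘ sym , m≢i , m≢l) (no-disjoint-pairs tjm til)
      ...       | yes refl = contradiction (disjoint (Tight-sym til) , disjoint (tight-pair i∈ j∈ i≢j t) , disjoint (Tight-sym tjm))
          (no-disjoint-triple (Tight.j∈ tjm) (tight-pair i∈ j∈ i≢j t) m≢i m≢j)
        where
        disjoint : ∀ {g h} → Tight S X r J n g h → count (both S g h) X ≡ 0
        disjoint {g} {h} (tight-pair g∈ h∈ g≢h t) with count (both S g h) X in c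
        ... | zero = refl
        ... | suc _ = contradiction (lose g∈ (lose h∈ (g≢h , subst (λ c → r + c ≤ n g + n h) (sym c) t ,
                        subst (1 ≤_) (sym c) (s≤s z≤n)))) ¬meeting

    -- Rejecting an element that lies in at most one set makes up for the whole excess of Σ z over 2q.
    discard : ∀ {S X r q J n z x} → State S X r (suc q) J n z → x ∈ X →
      count (λ i → S i x) J ≤ 1 → (∀ {i} → i ∈ J → z i < suc q) →
      ∑ (λ i → 2 * z i ∸ 1) J + 3 ≤ 4 * suc q → 2 * suc q < ∑ z J → ∑ n J ≤ 2 * r → Selection S X r J n
    discard {S} {X} {r} {q} {J} {n} {z} {x} st x∈ In≤1 z<q ∑z-bound ∑z> ∑n≤2r with X′ , X↭ ← ∈⇒↭ x∈ =
      unflip st (extend (select-balanced X′ state ∑z′≤ (≤-trans (∑-J′ n) ∑n≤2r)))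
      where
      -- Only two sets that both contain `x` could block its rejection, and there are none.
      loose : ∀ {i j} → i ∈ J → j ∈ J → i ≢ j → flip S i x ≡ false → flip S j x ≡ false →
              z i + z j < suc q + count (both (flip S) i j) X
      loose i∈ j∈ i≢j x∈i x∈j = contradiction In≤1
        (<⇒≱ (pair-count (λ i → S i x) i∈ j∈ i≢j (not-false x∈i) (not-false x∈j)))
      open Step (flip-state st) X↭ z<q loose
      double : ∀ J → (∀ {i} → i ∈ J → 1 ≤ z i) → 2 * ∑ z J ≡ ∑ (λ i → 2 * z i ∸ 1) J + length J
      double [] _ = refl
      double (i ∷ J) z>0 = trans (e₁ (z i) (∑ z J)) (trans (cong₂ _+_ (pos (z i) (z>0 (here refl))) (double J (z>0 ∘ there)))
          (e₂ (2 * z i ∸ 1) (∑ (λ i → 2 * z i ∸ 1) J) (length J)))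
        where
        e₁ : ∀ a b → 2 * (a + b) ≡ 2 * a + 2 * b
        e₁ = solve-∀
        e₂ : ∀ a b c → a + 1 + (b + c) ≡ a + b + suc c
        e₂ = solve-∀
        pos : ∀ m → 1 ≤ m → 2 * m ≡ 2 * m ∸ 1 + 1
        pos (suc m) _ = +-comm 1 (m + suc (m + 0))
      arith : ∀ A O Z D I → A + O ≤ Z → 2 * Z ≡ D + (O + I) → I ≤ 1 → D + 3 ≤ 4 * suc q → 2 * suc q < Z → A ≤ 2 * q
      arith A O Z D I A+O≤ 2Z I≤1 D≤ Z> = *-cancelˡ-≤ 2 (linear 2
        (+-mono-≤ (≤-trans (*-monoʳ-≤ 2 A+O≤) (≤-reflexive 2Z)) (+-mono-≤ D≤ (+-mono-≤ I≤1 4≤O))) (e₂ A O D I q))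
        where
        e₁ : ∀ O D I q → 4 + (D + (O + I) + (4 * suc q + 1)) + 0 ≡ O + (2 * suc (2 * suc q) + (D + 3 + I))
        e₁ = solve-∀
        -- `2 * Z ≥ 4 * q + 6` and `D ≤ 4 * q + 1` leave at least five sets, at most one of which
        -- contains `x`. Then `2 * A ≤ D + I - O ≤ 4 * q - 2`.
        4≤O : 4 ≤ O
        4≤O = linear 0 (+-mono-≤ (≤-trans (*-monoʳ-≤ 2 Z>) (≤-reflexive 2Z)) (+-mono-≤ D≤ I≤1)) (e₁ O D I q)
        e₂ : ∀ A O D I q → 2 * A + (D + (O + I) + (4 * suc q + (1 + O))) + 2 ≡ 2 * (2 * q) + (2 * (A + O) + (D + 3 + (I + 4)))
        e₂ = solve-∀
      ∑z′≤ : ∑ n′ J′ ≤ 2 * q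
      ∑z′≤ = arith (∑ n′ J′) (count (λ i → not (S i x)) J) (∑ z J) _ (count (λ i → S i x) J) ∑-n′
        (trans (double J (State.z>0 st)) (cong (∑ (λ i → 2 * z i ∸ 1) J +_) (sym (count-not (λ i → S i x) J))))
        In≤1 ∑z-bound ∑z>

    deficit : ∀ {N Z r q} → N + Z < 2 * r + 2 * q → 2 * q < Z → N < 2 * r
    deficit {N} {Z} {r} {q} total Z> = linear 1 (+-mono-≤ total Z>) (e N Z r q)
      where
      e : ∀ N Z r q → suc N + (2 * r + 2 * q + Z) + 1 ≡ 2 * r + (suc (N + Z) + suc (2 * q))
      e = solve-∀

    -- The excess of Σ z over 2q is less than half the number of sets.  While it is positive,
    -- elements of at least two sets are chosen, until an element of at most one set appears.
    select : ∀ r {S X q J n z} → State S X r q J n z → ∑ n J + ∑ z J < 2 * r + 2 * q →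
      ∑ (λ i → 2 * z i ∸ 1) J + 3 ≤ 4 * q → (∀ {i} → i ∈ J → z i < q) → ∑ n J ≤ 2 * r → Selection S X r J n
    select zero st _ _ _ ∑n≤0 = select-disjoint st ∑n≤0
    -- Without rejections left, `z<q` rules out all demands.
    select (suc r) {q = zero} {J} {z = z} st _ _ z<q _ =
      select-disjoint st (≤-trans (≤-reflexive (cong (∑ _) (empty J z<q))) z≤n)
      where
      empty : ∀ J → (∀ {i} → i ∈ J → z i < 0) → J ≡ []
      empty [] _ = refl
      empty (i ∷ J) z<0 = contradiction (z<0 (here refl)) λ ()
    select (suc r) {S} {X} {suc q} {J} {n} {z} st total ∑z-bound z<q ∑n≤2r
      with ∑ z J ≤? 2 * suc q | any? (λ i → n i ≟ℕ suc r) J | any? (λ x → count (λ i → S i x) J ≤? 1) X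
    ... | yes ∑z≤2q | _ | _ = select-balanced X st ∑n≤2r ∑z≤2q
    ... | no _ | yes p | _ with i , i∈ , ni≡r ← find p = saturated st i∈ ni≡r ∑n≤2r
    ... | no ∑z≰2q | no _ | yes p with x , x∈ , In≤1 ← find p =
      discard st x∈ In≤1 z<q ∑z-bound (≰⇒> ∑z≰2q) ∑n≤2r
    -- Every element now lies in at least two sets, so choosing a free one lowers `∑ n` by two, in
    -- step with `2 * r`, while `q` and `z` stay.
    ... | no ∑z≰2q | no n≢r | no thick
      with x , x∈ , ¬b ← Crowded.free-element st (deficit {r = suc r} {q = suc q} total (≰⇒> ∑z≰2q)) ∑z-bound
                           (subst (0 <_) (sym (State.size st)) (s≤s z≤n))
      with X′ , X↭ ← ∈⇒↭ x∈ =
      extend (select r state total′ (≤-trans (+-monoˡ-≤ 3 (∑-J′ _)) ∑z-bound) (z<q ∘ J′⊆J) ∑n′≤)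
      where
      open Step st X↭ (λ i∈ → ≤∧≢⇒< (State.n≤r st i∈) λ eq → n≢r (lose i∈ eq))
        (λ i∈ j∈ i≢j x∉i x∉j → ≰⇒> λ t → ¬b (tightOutside i∈ j∈ i≢j x∉i x∉j t))
      drop-2 : ∑ n′ J′ + 2 ≤ ∑ n J
      drop-2 = ≤-trans (+-monoʳ-≤ (∑ n′ J′) (≰⇒> λ In≤1 → thick (lose x∈ In≤1))) ∑-n′
      total′ : ∑ n′ J′ + ∑ z J′ < 2 * r + 2 * suc q
      total′ = linear 0 (+-mono-≤ (+-mono-≤ drop-2 (∑-J′ z)) total)
        (e (∑ n′ J′) (∑ z J′) (∑ n J) (∑ z J) r q)
        where
        e : ∀ A B N Z r q → suc (A + B) + (N + Z + (2 * suc r + 2 * suc q)) + 0 ≡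
                            2 * r + 2 * suc q + (A + 2 + B + suc (N + Z))
        e = solve-∀
      ∑n′≤ : ∑ n′ J′ ≤ 2 * r
      ∑n′≤ = linear 0 (+-mono-≤ drop-2 ∑n≤2r) (e (∑ n′ J′) (∑ n J) r)
        where
        e : ∀ A N r → A + (N + 2 * suc r) + 0 ≡ 2 * r + (A + 2 + N)
        e = solve-∀

  -- Sums over unordered pairs

  ∑∑ : ∀ {A : Set} → (A → A → ℕ) → List A → ℕ
  ∑∑ φ [] = 0
  ∑∑ φ (x ∷ xs) = ∑ (φ x) xs + ∑∑ φ xs

  module Excess (L : ℕ) where

    excess : ℕ → ℕ → ℕ
    excess x y = x + y ∸ L

    ∑∑-excess-zero : ∀ xs → sum xs ≤ L → ∑∑ excess xs ≡ 0
    ∑∑-excess-zero [] _ = refl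
    ∑∑-excess-zero (x ∷ xs) h = cong₂ _+_
      (n≤0⇒n≡0 (≤-trans (∑-≤-* xs λ {y} y∈ →
        ≤-reflexive (m≤n⇒m∸n≡0 (≤-trans (+-monoʳ-≤ x (y≤ xs y∈)) h))) (≤-reflexive (*-zeroʳ (length xs)))))
      (∑∑-excess-zero xs (m+n≤o⇒n≤o x h))
      where
      y≤ : ∀ {y} xs → y ∈ xs → y ≤ sum xs
      y≤ (x ∷ xs) (here refl) = m≤m+n x _
      y≤ (x ∷ xs) (there y∈) = m≤n⇒m≤o+n x (y≤ xs y∈)

    -- If both terms on the left are positive, the two sides differ by `L - c`; otherwise
    -- monotonicity suffices.
    excess-+ : ∀ x y c → c ≤ L → excess x c + excess y c ≤ excess (x + y) c
    excess-+ x y c c≤L with ≤-total (x + c) L | ≤-total (y + c) L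
    ... | inj₁ xc≤ | _ rewrite m≤n⇒m∸n≡0 xc≤ = ∸-monoˡ-≤ L (+-monoˡ-≤ c (m≤n+m y x))
    ... | inj₂ _ | inj₁ yc≤ rewrite m≤n⇒m∸n≡0 yc≤ | +-identityʳ (x + c ∸ L) =
      ∸-monoˡ-≤ L (+-monoˡ-≤ c (m≤m+n x y))
    ... | inj₂ L≤xc | inj₂ L≤yc = m+n≤o⇒m≤o∸n _ (linear 0
      (+-mono-≤ c≤L (≤-reflexive (cong₂ _+_ (m∸n+n≡m L≤xc) (m∸n+n≡m L≤yc))))
      (e x y c L (x + c ∸ L) (y + c ∸ L)))
      where
      e : ∀ x y c L p s → p + s + L + (L + (x + c + (y + c))) + 0 ≡ x + y + c + (c + (p + L + (s + L)))
      e = solve-∀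

    -- If both terms are positive, they add up to `c` plus `x + y + c - 2 * L`, which is `c` at
    -- most.
    excess-≤ : ∀ x y c → x ≤ L → y ≤ L → x + y + c ≤ 2 * L → excess x c + excess y c ≤ c
    excess-≤ x y c x≤L y≤L h with ≤-total (x + c) L | ≤-total (y + c) L
    ... | inj₁ xc≤ | _ rewrite m≤n⇒m∸n≡0 xc≤ = m≤n+o⇒m∸n≤o (y + c) L (+-monoˡ-≤ c y≤L)
    ... | inj₂ _ | inj₁ yc≤ rewrite m≤n⇒m∸n≡0 yc≤ | +-identityʳ (x + c ∸ L) = m≤n+o⇒m∸n≤o (x + c) L (+-monoˡ-≤ c x≤L)
    ... | inj₂ L≤xc | inj₂ L≤yc = linear 0
      (+-mono-≤ h (≤-reflexive (cong₂ _+_ (m∸n+n≡m L≤xc) (m∸n+n≡m L≤yc))))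
      (e x y c L (x + c ∸ L) (y + c ∸ L))
      where
      e : ∀ x y c L p s → p + s + (2 * L + (x + c + (y + c))) + 0 ≡ c + (x + y + c + (p + L + (s + L)))
      e = solve-∀

    -- Merging two numbers whose sum is at most L only increases the total excess.
    ∑∑-excess-∷ : ∀ x ys → x ≤ L → All (_≤ L) ys → x + sum ys ≤ 2 * L →
                  ∑∑ excess (x ∷ ys) ≤ x + sum ys ∸ L
    ∑∑-excess-∷ x [] _ _ _ = z≤n
    ∑∑-excess-∷ x (y ∷ zs) x≤L (y≤L ∷ zs≤L) h with ≤-total (x + y) L
    ... | inj₁ xy≤L = begin
      excess x y + ∑ (excess x) zs + (∑ (excess y) zs + ∑∑ excess zs)
        ≡⟨ cong (λ m → m + ∑ (excess x) zs + (∑ (excess y) zs + ∑∑ excess zs)) (m≤n⇒m∸n≡0 xy≤L) ⟩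
      ∑ (excess x) zs + (∑ (excess y) zs + ∑∑ excess zs)
        ≡⟨ +-assoc (∑ (excess x) zs) _ _ ⟨
      ∑ (excess x) zs + ∑ (excess y) zs + ∑∑ excess zs
        ≡⟨ cong (_+ ∑∑ excess zs) (∑-+ (excess x) (excess y) zs) ⟨
      ∑ (λ c → excess x c + excess y c) zs + ∑∑ excess zs
        ≤⟨ +-monoˡ-≤ _ (∑-mono zs λ {c} c∈ → excess-+ x y c (All.lookup zs≤L c∈)) ⟩
      ∑∑ excess (x + y ∷ zs)
        ≤⟨ ∑∑-excess-∷ (x + y) zs xy≤L zs≤L (≤-trans (≤-reflexive (+-assoc x y (sum zs))) h) ⟩
      x + y + sum zs ∸ L
        ≡⟨ cong (_∸ L) (+-assoc x y (sum zs)) ⟩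
      x + (y + sum zs) ∸ L ∎
      where open ≤-Reasoning
    -- Now `zs` adds up to at most `L`, so its own pairs have no excess, and by `excess-≤` each
    -- entry has excess at most itself with `x` and `y` together.
    ... | inj₂ L≤xy = begin
      excess x y + ∑ (excess x) zs + (∑ (excess y) zs + ∑∑ excess zs)
        ≡⟨ cong (λ m → excess x y + ∑ (excess x) zs + (∑ (excess y) zs + m)) (∑∑-excess-zero zs zs≤) ⟩
      excess x y + ∑ (excess x) zs + (∑ (excess y) zs + 0)
        ≡⟨ assoc (excess x y) (∑ (excess x) zs) (∑ (excess y) zs) ⟩
      excess x y + (∑ (excess x) zs + ∑ (excess y) zs)
        ≡⟨ cong (excess x y +_) (∑-+ (excess x) (excess y) zs) ⟨
      excess x y + ∑ (λ c → excess x c + excess y c) zs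
        ≤⟨ +-monoʳ-≤ (excess x y) (∑-mono zs λ {c} c∈ → excess-≤ x y c x≤L y≤L
             (≤-trans (+-monoʳ-≤ (x + y) (∈-sum zs c∈)) (≤-trans (≤-reflexive (+-assoc x y _)) h))) ⟩
      excess x y + ∑ id zs
        ≡⟨ cong (excess x y +_) (∑-id zs) ⟩
      excess x y + sum zs
        ≡⟨ +-∸-comm (sum zs) L≤xy ⟨
      x + y + sum zs ∸ L
        ≡⟨ cong (_∸ L) (+-assoc x y (sum zs)) ⟩
      x + (y + sum zs) ∸ L ∎
      where
      open ≤-Reasoning
      assoc : ∀ a b c → a + b + (c + 0) ≡ a + (b + c)
      assoc = solve-∀
      ∑-id : ∀ zs → ∑ id zs ≡ sum zs
      ∑-id [] = refl
      ∑-id (z ∷ zs) = cong (z +_) (∑-id zs)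
      ∈-sum : ∀ {y} xs → y ∈ xs → y ≤ sum xs
      ∈-sum (x ∷ xs) (here refl) = m≤m+n x _
      ∈-sum (x ∷ xs) (there y∈) = m≤n⇒m≤o+n x (∈-sum xs y∈)
      zs≤ : sum zs ≤ L
      zs≤ = linear 0 (+-mono-≤ h L≤xy) (e x y (sum zs) L)
        where
        e : ∀ x y s L → s + (2 * L + (x + y)) + 0 ≡ L + (x + (y + s) + L)
        e = solve-∀

    ∑∑-excess : ∀ xs → All (_≤ L) xs → sum xs ≤ 2 * L → ∑∑ excess xs ≤ sum xs ∸ L
    ∑∑-excess [] _ _ = z≤n
    ∑∑-excess (x ∷ xs) (x≤L ∷ xs≤L) h = ∑∑-excess-∷ x xs x≤L xs≤L h

  -- Walks and odd cycles

  isOdd : ℕ → Bool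
  isOdd zero = false
  isOdd (suc m) = not (isOdd m)

  isOdd-+ : ∀ m n → isOdd (m + n) ≡ isOdd m xor isOdd n
  isOdd-+ zero n = refl
  isOdd-+ (suc m) n = trans (cong not (isOdd-+ m n)) (not-distribˡ-xor (isOdd m) (isOdd n))

  isOdd⇒%2 : ∀ m → isOdd m ≡ true → m % 2 ≡ 1
  isOdd⇒%2 1 _ = refl
  isOdd⇒%2 (suc (suc m)) h = trans (cong (_% 2) (+-comm 2 m))
    (trans ([m+n]%n≡m%n m 2) (isOdd⇒%2 m (trans (sym (not-involutive (isOdd m))) h)))

  words-complete : ∀ {A : Set} {xs : List A} {w} → All (_∈ xs) w → w ∈ words xs (length w)
  words-complete [] = here refl
  words-complete (x∈ ∷ w∈) = ∈-cartesianProductWith⁺ _∷_ x∈ (words-complete w∈)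

  module Walks (G : Graph) where
    open Graph G hiding (sym)

    data Walk : Vertex → Vertex → ℕ → Set where
      []  : ∀ {u} → Walk u u 0
      _∷_ : ∀ {u v w m} → Adj u v → Walk v w m → Walk u w (suc m)

    _++ʷ_ : ∀ {u v w m n} → Walk u v m → Walk v w n → Walk u w (m + n)
    [] ++ʷ q = q
    (e ∷ p) ++ʷ q = e ∷ (p ++ʷ q)

    reverseʷ : ∀ {u v m} → Walk u v m → Walk v u m
    reverseʷ {m = zero} [] = []
    reverseʷ {u} {v} {suc m} (e ∷ p) =
      subst (Walk v u) (+-comm m 1) (reverseʷ p ++ʷ (Graph.sym G e ∷ []))

    -- The final vertex is left out, so that a closed walk lists its starting vertex once, as
    -- `IsCycle` expects.
    vertices : ∀ {u v m} → Walk u v m → List Vertex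
    vertices [] = []
    vertices {u} (_ ∷ p) = u ∷ vertices p

    length-vertices : ∀ {u v m} (p : Walk u v m) → length (vertices p) ≡ m
    length-vertices [] = refl
    length-vertices (_ ∷ p) = cong suc (length-vertices p)

    linked : ∀ {u v m} (p : Walk u v m) → Linked Adj (vertices p ∷ʳ v)
    linked [] = [-]
    linked (e ∷ []) = e ∷ [-]
    linked (e ∷ p@(_ ∷ _)) = e ∷ linked p

    splitAt : ∀ {u v x m} (p : Walk u v m) → x ∈ vertices p →
      ∃₂ λ m₁ m₂ → Walk u x m₁ × Walk x v (suc m₂) × m₁ + suc m₂ ≡ m
    splitAt (e ∷ p) (here refl) = 0 , _ , [] , (e ∷ p) , refl
    splitAt (e ∷ p) (there x∈) with m₁ , m₂ , p₁ , p₂ , eq ← splitAt p x∈ =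
      suc m₁ , m₂ , e ∷ p₁ , p₂ , cong suc eq

    -- Both `loop` and `after` are nonempty, so the loop and the walk without it are each strictly
    -- shorter than the whole.
    record Detour (u v : Vertex) (m : ℕ) : Set where
      field
        {x}        : Vertex
        {m₁ m₂ m₃} : ℕ
        before     : Walk u x m₁
        loop       : Walk x x (suc m₂)
        after      : Walk x v (suc m₃)
        total      : m₁ + (suc m₂ + suc m₃) ≡ m

    path⊎detour : ∀ {u v m} (p : Walk u v m) → Unique (vertices p) ⊎ Detour u v m
    path⊎detour [] = inj₁ []
    path⊎detour {u} (e ∷ p) with _∈?_ Fin._≟_ u (vertices p)
    ... | yes u∈ with m₁ , m₂ , p₁ , p₂ , eq ← splitAt p u∈ =
      inj₂ record { before = [] ; loop = e ∷ p₁ ; after = p₂ ; total = cong suc eq }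
    ... | no u∉ with path⊎detour p
    ...   | inj₁ uniq = inj₁ (All.¬Any⇒All¬ _ u∉ ∷ uniq)
    ...   | inj₂ d = inj₂ record
      { before = e ∷ Detour.before d ; loop = Detour.loop d ; after = Detour.after d
      ; total = cong suc (Detour.total d) }

    OddCycle≤ : ℕ → Set
    OddCycle≤ m = ∃ λ c → IsCycle G c × isOdd (length c) ≡ true × length c ≤ m

    -- Cutting a closed walk at a repeated vertex leaves two shorter closed walks, one of them odd.
    -- `N` bounds the depth of the recursion.
    oddWalk⇒oddCycle : ∀ N {u m} → m ≤ N → Walk u u m → isOdd m ≡ true → OddCycle≤ m
    oddWalk⇒oddCycle N m≤N p odd with path⊎detour p
    -- Odd length means length 1, excluded by irreflexivity, or at least 3, as a cycle requires.
    oddWalk⇒oddCycle N m≤N (e ∷ []) odd | inj₁ _ = contradiction e (irrefl refl)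
    oddWalk⇒oddCycle N m≤N p@(_ ∷ _ ∷ _ ∷ q) odd | inj₁ uniq =
      vertices p , (s≤s (s≤s (s≤s z≤n)) , uniq , linked p)
      , trans (cong isOdd (length-vertices p)) odd , ≤-reflexive (length-vertices p)
    oddWalk⇒oddCycle zero z≤n [] () | inj₂ d
    oddWalk⇒oddCycle (suc N) {u} {m} m≤N p odd | inj₂ d = go (isOdd (suc m₂)) refl
      where
      open Detour d
      bound₁ : suc m₂ < m
      bound₁ = ≤-trans (≤-trans (≤-reflexive (+-comm 1 (suc m₂))) (+-monoʳ-≤ (suc m₂) (s≤s z≤n)))
        (≤-trans (m≤n+m (suc m₂ + suc m₃) m₁) (≤-reflexive total))
      rest : m₁ + suc m₃ + suc m₂ ≡ m
      rest = trans (e m₁ (suc m₂) (suc m₃)) total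
        where
        e : ∀ a b c → a + c + b ≡ a + (b + c)
        e = solve-∀
      bound₂ : m₁ + suc m₃ < m
      bound₂ = ≤-trans (≤-trans (≤-reflexive (+-comm 1 (m₁ + suc m₃))) (+-monoʳ-≤ (m₁ + suc m₃) (s≤s z≤n)))
        (≤-reflexive rest)
      shrink : ∀ {l} → l < m → OddCycle≤ l → OddCycle≤ m
      shrink l<m (c , cyc , par , c≤) = c , cyc , par , ≤-trans c≤ (<⇒≤ l<m)
      go : ∀ b → isOdd (suc m₂) ≡ b → OddCycle≤ m
      go true par = shrink bound₁ (oddWalk⇒oddCycle N (≤-pred (≤-trans bound₁ m≤N)) loop par)
      go false par = shrink bound₂ (oddWalk⇒oddCycle N (≤-pred (≤-trans bound₂ m≤N)) (before ++ʷ after)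
        (trans (sym (xor-identityʳ (isOdd (m₁ + suc m₃))))
          (trans (cong (isOdd (m₁ + suc m₃) xor_) (sym par))
            (trans (sym (isOdd-+ (m₁ + suc m₃) (suc m₂))) (trans (cong isOdd rest) odd)))))

    -- The vertices are distinct, so the length is at most `order` and the enumeration reaches the
    -- cycle.
    cycle∈cycles : ∀ {c} → IsCycle G c → c ∈ cycles G
    cycle∈cycles {c@(_ ∷ _)} cyc@(_ , uniq , _) = ∈-filter⁺ (isCycle? G)
      (∈-concatMap⁺ (words (allFin order)) (Any.map (λ { refl → words-complete (All.tabulate λ {x} _ → ∈-allFin x) })
        (∈-upTo⁺ {n = suc order} (s≤s (≤-trans (length-⊆ uniq λ {x} _ → ∈-allFin x) (≤-reflexive (length-tabulate {n = order} (λ i → i))))))))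
      cyc

    oddGirth≤ : ∀ {c} → IsCycle G c → isOdd (length c) ≡ true → oddGirth G ≤⁺ [ length c ]
    oddGirth≤ {c} cyc odd = All.lookup (min≤xs _ _)
      (∈-map⁺ ([_] ∘ length) (∈-filter⁺ (λ c → length c % 2 ≟ℕ 1) (cycle∈cycles cyc) (isOdd⇒%2 (length c) odd)))

    oddGirth≤oddWalk : ∀ {L u m} → [ L ] ≤⁺ oddGirth G → Walk u u m → isOdd m ≡ true → L ≤ m
    oddGirth≤oddWalk og p odd with c , cyc , par , c≤m ← oddWalk⇒oddCycle _ ≤-refl p odd
      with Sup.[ L≤c ] ← Sup.≤⁺-trans ≤-trans og (oddGirth≤ cyc par) = ≤-trans L≤c c≤m

  -- Eliminating a vertex

  module _ {A : Set} where
    ∑-≥-* : ∀ {f : A → ℕ} {m} xs → (∀ {x} → x ∈ xs → m ≤ f x) → length xs * m ≤ ∑ f xs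
    ∑-≥-* [] h = z≤n
    ∑-≥-* (x ∷ xs) h = +-mono-≤ (h (here refl)) (∑-≥-* xs (h ∘ there))

    handshake : ∀ {φ : A → A → ℕ} → (∀ x y → φ x y ≡ φ y x) → (∀ x → φ x x ≡ 0) →
                ∀ xs → ∑ (λ x → ∑ (φ x) xs) xs ≡ 2 * ∑∑ φ xs
    handshake φ-sym φ-diag [] = refl
    handshake {φ} φ-sym φ-diag (x ∷ xs) = begin
      φ x x + ∑ (φ x) xs + ∑ (λ y → φ y x + ∑ (φ y) xs) xs
        ≡⟨ cong₂ (λ a b → a + ∑ (φ x) xs + b) (φ-diag x) (∑-+ (λ y → φ y x) (λ y → ∑ (φ y) xs) xs) ⟩
      ∑ (φ x) xs + (∑ (λ y → φ y x) xs + ∑ (λ y → ∑ (φ y) xs) xs)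
        ≡⟨ cong₂ (λ a b → ∑ (φ x) xs + (a + b)) (∑-cong xs λ {y} _ → φ-sym y x) (handshake φ-sym φ-diag xs) ⟩
      ∑ (φ x) xs + (∑ (φ x) xs + 2 * ∑∑ φ xs)
        ≡⟨ e (∑ (φ x) xs) (∑∑ φ xs) ⟩
      2 * (∑ (φ x) xs + ∑∑ φ xs) ∎
      where
      open ≡-Reasoning
      e : ∀ a b → a + (a + 2 * b) ≡ 2 * (a + b)
      e = solve-∀

  module Elimination {V : Set} (_≟_ : DecidableEquality V) (L : ℕ) where
    open Excess L

    -- The first argument is the parity of an edge (true for odd); weight 0 stands for no edge.
    Weights : Set
    Weights = Bool → V → V → ℕ

    weight : Weights → V → V → ℕ
    weight a u w = a false u w + a true u w

    -- The walk from `u` through `v` to `w`: its first edge has parity `δ` and its second `δ xor ε`,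
    -- so its parity is `ε`. Lengths `L - a` and `L - b` add up to `L - (a + b - L)`.
    via : Weights → V → Bool → Weights
    via a v δ ε u w = a δ v u + a (δ xor ε) v w ∸ L

    -- Edges of one parity between two vertices make the same kind of demand, so the largest weight
    -- implies the others. No vertex is joined to itself: the two edges between `v` and one
    -- neighbour are controlled by `a+a≤L` instead.
    eliminate : Weights → V → Weights
    eliminate a v ε u w =
      if does (u ≟ w) then 0 else a ε u w ⊔ (via a v false ε u w ⊔ via a v true ε u w)

    Dense : Weights → List V → Set
    Dense a U = ∀ W → Unique W → (∀ {u} → u ∈ W → u ∈ U) → 0 < length W →
                ∑∑ (weight a) W < L * length W

    remove : V → List V → List V
    remove v = filter (λ u → ¬? (v ≟ u))

    ∈-remove⁻ : ∀ {v u U} → u ∈ remove v U → u ∈ U × v ≢ u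
    ∈-remove⁻ {v} {U = U} = ∈-filter⁻ (λ u → ¬? (v ≟ u)) {xs = U}

    ∈-remove⁺ : ∀ {v u U} → u ∈ U → v ≢ u → u ∈ remove v U
    ∈-remove⁺ {v} = ∈-filter⁺ (λ u → ¬? (v ≟ u))

    -- Degrees of at least `2 * L` everywhere would, by double counting, make the total weight at
    -- least `L * length U`.
    low-degree : ∀ {a U} → (∀ ε u w → a ε u w ≡ a ε w u) → (∀ ε u → a ε u u ≡ 0) →
      Unique U → Dense a U → 0 < length U → ∃ λ v → v ∈ U × ∑ (weight a v) U < 2 * L
    low-degree {a} {U} a-sym a-diag unique dense U>0 with any? (λ v → ∑ (weight a v) U <? 2 * L) U
    ... | yes p = find p
    ... | no ¬p = contradiction (dense U unique id U>0) (≤⇒≯ (*-cancelˡ-≤ 2 (begin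
      2 * (L * length U)                          ≡⟨ e L (length U) ⟩
      length U * (2 * L)                          ≤⟨ ∑-≥-* U (λ v∈ → ≮⇒≥ λ lt → ¬p (lose v∈ lt)) ⟩
      ∑ (λ v → ∑ (weight a v) U) U                ≡⟨ handshake (λ u w → cong₂ _+_ (a-sym false u w) (a-sym true u w))
                                                       (λ u → cong₂ _+_ (a-diag false u) (a-diag true u)) U ⟩
      2 * ∑∑ (weight a) U                         ∎)))
      where
      open ≤-Reasoning
      e : ∀ l m → 2 * (l * m) ≡ m * (2 * l)
      e = solve-∀

    module AtVertex (a : Weights) (v : V) where

      -- Both parities enter one list, so that its unordered pairs of entries include every walk
      -- through `v`.
      spokes : List V → List ℕ
      spokes [] = []
      spokes (u ∷ W) = a false v u ∷ a true v u ∷ spokes W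

      sum-spokes : ∀ W → sum (spokes W) ≡ ∑ (weight a v) W
      sum-spokes [] = refl
      sum-spokes (u ∷ W) = trans (sym (+-assoc (a false v u) _ _)) (cong (weight a v u +_) (sum-spokes W))

      spokes-≤ : (∀ ε u → a ε v u ≤ L) → ∀ W → All (_≤ L) (spokes W)
      spokes-≤ a≤L [] = []
      spokes-≤ a≤L (u ∷ W) = a≤L false u ∷ a≤L true u ∷ spokes-≤ a≤L W

      eliminate-≤ : ∀ ε u w → eliminate a v ε u w ≤ a ε u w + (via a v false ε u w + via a v true ε u w)
      eliminate-≤ ε u w with does (u ≟ w)
      ... | true = z≤n
      ... | false = ≤-trans (m⊔n≤m+n (a ε u w) _) (+-monoʳ-≤ (a ε u w) (m⊔n≤m+n (via a v false ε u w) _))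

      -- A maximum is at most the sum, and the four walks from `u` through `v` to `w` combine each
      -- edge `vu` with each edge `vw`.
      ∑-eliminate : ∀ u W → ∑ (weight (eliminate a v) u) W ≤
        ∑ (weight a u) W + (∑ (excess (a false v u)) (spokes W) + ∑ (excess (a true v u)) (spokes W))
      ∑-eliminate u [] = z≤n
      ∑-eliminate u (w ∷ W) = ≤-trans
        (+-mono-≤ (+-mono-≤ (eliminate-≤ false u w) (eliminate-≤ true u w)) (∑-eliminate u W))
        (≤-reflexive (e (a false u w) (a true u w) (excess (a false v u) (a false v w)) (excess (a true v u) (a true v w))
          (excess (a false v u) (a true v w)) (excess (a true v u) (a false v w)) _ (∑ (excess (a false v u)) (spokes W)) _))
        where
        e : ∀ a b p q r s t x y → a + (p + q) + (b + (r + s)) + (t + (x + y)) ≡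
                                  a + b + t + (p + (r + x) + (s + (q + y)))
        e = solve-∀

      ∑∑-eliminate : ∀ W → ∑∑ (weight (eliminate a v)) W ≤ ∑∑ (weight a) W + ∑∑ excess (spokes W)
      ∑∑-eliminate [] = z≤n
      ∑∑-eliminate (u ∷ W) = ≤-trans (+-mono-≤ (∑-eliminate u W) (∑∑-eliminate W))
        -- The pair formed by the even and the odd edge between `v` and `u` occurs in `∑∑ excess`
        -- but creates no edge.
        (≤-trans (m≤m+n _ (excess (a false v u) (a true v u)))
          (≤-reflexive (e (∑ (weight a u) W) (∑ (excess (a false v u)) (spokes W)) (∑ (excess (a true v u)) (spokes W))
             (∑∑ (weight a) W) (∑∑ excess (spokes W)) (excess (a false v u) (a true v u)))))
        where
        e : ∀ x y z s t p → x + (y + z) + (s + t) + p ≡ x + s + (p + y + (z + t))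
        e = solve-∀

      -- If W has degree at most L at v, its new edges are trivial; otherwise they weigh at most the
      -- edges at v minus L, which is what deleting v from W ∪ {v} costs.
      dense : ∀ {U} → v ∈ U → (∀ ε u → a ε v u ≤ L) → ∑ (weight a v) U < 2 * L →
              Dense a U → Dense (eliminate a v) (remove v U)
      dense {U} v∈ a≤L degree dense-a W unique W⊆ W>0 = cases (≤-total s L)
        where
        s = ∑ (weight a v) W
        P = ∑∑ (weight a) W
        W⊆U : ∀ {u} → u ∈ W → u ∈ U
        W⊆U u∈ = proj₁ (∈-remove⁻ (W⊆ u∈))
        P′≤ : ∑∑ (weight (eliminate a v)) W ≤ P + (s ∸ L)
        P′≤ = ≤-trans (∑∑-eliminate W) (+-monoʳ-≤ P (subst (λ m → ∑∑ excess (spokes W) ≤ m ∸ L) (sum-spokes W)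
          (∑∑-excess (spokes W) (spokes-≤ a≤L W) (≤-trans (≤-reflexive (sum-spokes W))
            (≤-trans (∑-⊆ (weight a v) unique W⊆U) (<⇒≤ degree))))))
        cases : s ≤ L ⊎ L ≤ s → ∑∑ (weight (eliminate a v)) W < L * length W
        cases (inj₁ s≤L) = ≤-trans (s≤s (≤-trans P′≤ (≤-reflexive (trans (cong (P +_) (m≤n⇒m∸n≡0 s≤L)) (+-identityʳ P)))))
          (dense-a W unique W⊆U W>0)
        cases (inj₂ L≤s) = linear 0 (+-mono-≤ P′≤ (+-mono-≤ (dense-a (v ∷ W)
            (All.tabulate (λ u∈ → proj₂ (∈-remove⁻ {U = U} (W⊆ u∈))) ∷ unique) (λ { (here refl) → v∈ ; (there u∈) → W⊆U u∈ }) (s≤s z≤n))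
            (≤-reflexive (m∸n+n≡m L≤s))))
          (e (∑∑ (weight (eliminate a v)) W) P (s ∸ L) L s (length W))
          where
          e : ∀ P′ P t L s l → suc P′ + (P + t + (L * suc l + s)) + 0 ≡ L * l + (P′ + (suc (s + P) + (t + L)))
          e = solve-∀

      eliminate-sym : (∀ ε u w → a ε u w ≡ a ε w u) → ∀ ε u w → eliminate a v ε u w ≡ eliminate a v ε w u
      eliminate-sym a-sym ε u w with u ≟ w | w ≟ u
      ... | yes _ | yes _ = refl
      ... | yes refl | no w≢u = contradiction refl w≢u
      ... | no u≢w | yes refl = contradiction refl u≢w
      ... | no _ | no _ = cong₂ _⊔_ (a-sym ε u w) (mirror ε)
        where
        -- Reversing a walk exchanges the parities of its two edges; for odd `ε` this swaps the two
        -- values of `δ`.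
        mirror : ∀ ε → via a v false ε u w ⊔ via a v true ε u w ≡ via a v false ε w u ⊔ via a v true ε w u
        mirror false = cong₂ (λ x y → x ∸ L ⊔ (y ∸ L)) (+-comm (a false v u) _) (+-comm (a true v u) _)
        mirror true = trans (⊔-comm (via a v false true u w) _)
          (cong₂ (λ x y → x ∸ L ⊔ (y ∸ L)) (+-comm (a true v u) _) (+-comm (a false v u) _))

      eliminate-diag : ∀ ε u → eliminate a v ε u u ≡ 0
      eliminate-diag ε u with u ≟ u
      ... | yes _ = refl
      ... | no u≢u = contradiction refl u≢u

      eliminate-cases : ∀ ε u w → 1 ≤ eliminate a v ε u w →
        eliminate a v ε u w ≡ a ε u w ⊎ ∃ λ δ → eliminate a v ε u w ≡ via a v δ ε u w
      eliminate-cases ε u w pos with does (u ≟ w)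
      ... | false with ⊔-sel (a ε u w) (via a v false ε u w ⊔ via a v true ε u w)
      ...   | inj₁ eq = inj₁ eq
      ...   | inj₂ eq with ⊔-sel (via a v false ε u w) (via a v true ε u w)
      ...     | inj₁ eq′ = inj₂ (false , trans eq eq′)
      ...     | inj₂ eq′ = inj₂ (true , trans eq eq′)

      ≤eliminate : ∀ ε {u w} → u ≢ w → a ε u w ≤ eliminate a v ε u w
      ≤eliminate ε {u} {w} u≢w with u ≟ w
      ... | yes eq = contradiction eq u≢w
      ... | no _ = m≤m⊔n _ _

      via≤eliminate : ∀ δ ε {u w} → u ≢ w → via a v δ ε u w ≤ eliminate a v ε u w
      via≤eliminate δ ε {u} {w} u≢w with u ≟ w
      via≤eliminate δ ε u≢w | yes eq = contradiction eq u≢w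
      via≤eliminate false ε {u} {w} _ | no _ = ≤-trans (m≤m⊔n _ _) (m≤n⊔m (a ε u w) _)
      via≤eliminate true ε {u} {w} _ | no _ = ≤-trans (m≤n⊔m (via a v false ε u w) _) (m≤n⊔m (a ε u w) _)

  -- Colouring a weighted graph

  ⌈n/2⌉-odd : ∀ m → isOdd m ≡ true → ⌈ m /2⌉ ≡ suc ⌊ m /2⌋
  ⌈n/2⌉-odd 1 _ = refl
  ⌈n/2⌉-odd (suc (suc m)) h = cong suc (⌈n/2⌉-odd m (trans (sym (not-involutive (isOdd m))) h))

  ⌈n/2⌉-even : ∀ m → isOdd m ≡ false → ⌈ m /2⌉ ≡ ⌊ m /2⌋
  ⌈n/2⌉-even 0 _ = refl
  ⌈n/2⌉-even (suc (suc m)) h = cong suc (⌈n/2⌉-even m (trans (sym (not-involutive (isOdd m))) h))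

  isOdd-1+2* : ∀ k → isOdd (suc (2 * k)) ≡ true
  isOdd-1+2* k = cong not (trans (isOdd-+ k (k + 0)) (trans (cong (λ m → isOdd k xor isOdd m) (+-identityʳ k)) (xor-same (isOdd k))))

  xor-medial : ∀ a b c d → (a xor b) xor (c xor d) ≡ (a xor c) xor (b xor d)
  xor-medial a b c d = trans (xor-assoc a b (c xor d)) (trans (cong (a xor_)
    (trans (sym (xor-assoc b c d)) (trans (cong (_xor d) (xor-comm b c)) (xor-assoc c b d))))
    (sym (xor-assoc a c (b xor d))))

  module _ {A : Set} where

    count-cong : ∀ {p q : A → Bool} xs → (∀ x → p x ≡ q x) → count p xs ≡ count q xs
    count-cong xs h = ∑-cong xs λ {x} _ → cong ⟦_⟧ (h x)

    -- Agreement means both or neither, and `count-neither` expresses the latter through the former.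
    count-xnor : ∀ (p q : A → Bool) xs → count (λ x → not (p x xor q x)) xs + (count p xs + count q xs) ≡
                 length xs + 2 * count (λ x → p x ∧ q x) xs
    count-xnor p q xs = begin
      count (λ x → not (p x xor q x)) xs + s            ≡⟨ cong (_+ s) (∑-cong xs λ {x} _ → pointwise (p x) (q x)) ⟩
      ∑ (λ x → ⟦ not (p x) ∧ not (q x) ⟧ + ⟦ p x ∧ q x ⟧) xs + s
                                                        ≡⟨ cong (_+ s) (∑-+ (λ x → ⟦ not (p x) ∧ not (q x) ⟧) (λ x → ⟦ p x ∧ q x ⟧) xs) ⟩
      o + b + s                                         ≡⟨ e₁ o b s ⟩
      o + s + b                                         ≡⟨ cong (_+ b) (count-neither p q xs) ⟩
      length xs + b + b                                 ≡⟨ e₂ (length xs) b ⟩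
      length xs + 2 * b                                 ∎
      where
      open ≡-Reasoning
      s = count p xs + count q xs
      o = count (λ x → not (p x) ∧ not (q x)) xs
      b = count (λ x → p x ∧ q x) xs
      pointwise : ∀ a b → ⟦ not (a xor b) ⟧ ≡ ⟦ not a ∧ not b ⟧ + ⟦ a ∧ b ⟧
      pointwise true true = refl
      pointwise true false = refl
      pointwise false true = refl
      pointwise false false = refl
      e₁ : ∀ o b s → o + b + s ≡ o + s + b
      e₁ = solve-∀
      e₂ : ∀ l b → l + b + b ≡ l + 2 * b
      e₂ = solve-∀

    ++-disjoint : ∀ {x : A} xs {ys} → Unique (xs ++ ys) → x ∈ xs → x ∉ ys
    ++-disjoint (x ∷ xs) (x∉ ∷ _) (here refl) x∈ys = All.lookup x∉ (∈-++⁺ʳ xs x∈ys) refl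
    ++-disjoint (x ∷ xs) (_ ∷ u) (there x∈xs) x∈ys = ++-disjoint xs u x∈xs x∈ys

    module Membership (_≟_ : DecidableEquality A) where

      member : List A → A → Bool
      member xs x = does (_∈?_ _≟_ x xs)

      count-member : ∀ {X xs ys} p → Unique X → X ↭ xs ++ ys →
                     count (λ x → member xs x ∧ p x) X ≡ count p xs
      count-member {X} {xs} {ys} p uniq X↭ = trans (∑-↭ _ X↭) (trans (∑-++ _ xs)
        (trans (cong₂ _+_ (∑-cong xs inside) (n≤0⇒n≡0 (≤-trans (∑-≤-* ys outside) (≤-reflexive (*-zeroʳ (length ys))))))
          (+-identityʳ _)))
        where
        uniq′ : Unique (xs ++ ys)
        uniq′ = Permutation.Unique-resp-↭ (setoid A) (↭⇒↭ₛ X↭) uniq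
        inside : ∀ {x} → x ∈ xs → ⟦ member xs x ∧ p x ⟧ ≡ ⟦ p x ⟧
        inside {x} x∈ with _∈?_ _≟_ x xs
        ... | yes _ = refl
        ... | no x∉ = contradiction x∈ x∉
        outside : ∀ {x} → x ∈ ys → ⟦ member xs x ∧ p x ⟧ ≤ 0
        outside {x} x∈ with _∈?_ _≟_ x xs
        ... | yes x∈xs = contradiction x∈ (++-disjoint xs uniq′ x∈xs)
        ... | no _ = z≤n

    keys : List A → List (A × Bool)
    keys [] = []
    keys (x ∷ xs) = (x , false) ∷ (x , true) ∷ keys xs

    ∈-keys⁻ : ∀ {x δ xs} → (x , δ) ∈ keys xs → x ∈ xs
    ∈-keys⁻ {xs = x ∷ xs} (here refl) = here refl
    ∈-keys⁻ {xs = x ∷ xs} (there (here refl)) = here refl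
    ∈-keys⁻ {xs = x ∷ xs} (there (there i∈)) = there (∈-keys⁻ i∈)

    ∈-keys⁺ : ∀ {x xs} δ → x ∈ xs → (x , δ) ∈ keys xs
    ∈-keys⁺ false (here refl) = here refl
    ∈-keys⁺ true (here refl) = there (here refl)
    ∈-keys⁺ δ (there x∈) = there (there (∈-keys⁺ δ x∈))

    unique-keys : ∀ {xs} → Unique xs → Unique (keys xs)
    unique-keys [] = []
    unique-keys {x ∷ xs} (x∉ ∷ u) = ((λ ()) ∷ fresh) ∷ fresh ∷ unique-keys u
      where
      fresh : ∀ {δ} → All ((x , δ) ≢_) (keys xs)
      fresh = All.tabulate λ i∈ eq → All.lookup x∉ (∈-keys⁻ i∈) (cong proj₁ eq)

    ∑-keys : ∀ (f : A × Bool → ℕ) xs → ∑ f (keys xs) ≡ ∑ (λ x → f (x , false) + f (x , true)) xs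
    ∑-keys f [] = refl
    ∑-keys f (x ∷ xs) = trans (sym (+-assoc (f (x , false)) _ _)) (cong (f (x , false) + f (x , true) +_) (∑-keys f xs))

  module Colour (G : Graph) (k : ℕ)
    (long : ∀ {u m} → Walks.Walk G u u m → isOdd m ≡ true → suc (2 * k) ≤ m) where

    open Graph G using (Vertex)
    open Walks G using (Walk; []; _∷_; _++ʷ_; reverseʷ)

    L : ℕ
    L = suc (2 * k)

    open Elimination {Vertex} Fin._≟_ L

    X : List (Fin L)
    X = allFin L

    length-X : length X ≡ L
    length-X = length-tabulate {n = L} id

    Colours : Set
    Colours = Vertex → Fin L → Bool

    -- Even parity counts the coordinates where `p` and `q` agree, odd parity those where they
    -- differ.
    agree : Bool → (p q : Fin L → Bool) → ℕ
    agree ε p q = count (λ c → not ((p c xor q c) xor ε)) X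

    agree-sym : ∀ ε p q → agree ε p q ≡ agree ε q p
    agree-sym ε p q = count-cong X λ c → cong (λ b → not (b xor ε)) (xor-comm (p c) (q c))

    -- The invariant of the elimination. By `walk`, each edge stands for a walk in `G` of the same
    -- parity and of length `L - a`; through it the odd girth applies to later edges as well.
    record Weighted (U : List Vertex) (a : Weights) : Set where
      field
        a-sym  : ∀ ε u w → a ε u w ≡ a ε w u
        a-diag : ∀ ε u → a ε u u ≡ 0
        walk   : ∀ {ε u w} → 1 ≤ a ε u w → ∃ λ m → Walk u w m × isOdd m ≡ ε × m + a ε u w ≡ L
        dense  : Dense a U

      a≤L : ∀ ε u w → a ε u w ≤ L
      a≤L ε u w with a ε u w in eq
      ... | zero = z≤n
      ... | suc _ with m , _ , _ , total ← walk {ε} {u} {w} (subst (1 ≤_) (sym eq) (s≤s z≤n)) =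
        subst (_≤ L) eq (≤-trans (m≤n+m _ m) (≤-reflexive total))

      -- The two walks form an odd closed walk, of length at least `L`. Their lengths and the two
      -- weights add up to `2 * L`.
      a+a≤L : ∀ u w → a false u w + a true u w ≤ L
      a+a≤L u w with 1 ≤? a false u w | 1 ≤? a true u w
      ... | no z | _ = subst (λ m → m + a true u w ≤ L) (sym (n≤0⇒n≡0 (≤-pred (≰⇒> z)))) (a≤L true u w)
      ... | yes _ | no z = subst (λ m → a false u w + m ≤ L) (sym (n≤0⇒n≡0 (≤-pred (≰⇒> z))))
                             (≤-trans (≤-reflexive (+-identityʳ _)) (a≤L false u w))
      ... | yes p | yes q with m , P , even , total ← walk {false} {u} {w} p | m′ , Q , odd , total′ ← walk {true} {u} {w} q =
        linear 0 (+-mono-≤ (long (P ++ʷ reverseʷ Q) (trans (isOdd-+ m m′) (cong₂ _xor_ even odd)))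
                           (≤-reflexive (cong₂ _+_ total total′)))
          (e m m′ (a false u w) (a true u w) L)
        where
        e : ∀ m m′ a b L → a + b + (m + m′ + (L + L)) + 0 ≡ L + (L + (m + a + (m′ + b)))
        e = solve-∀

    record Proper (U : List Vertex) (a : Weights) (col : Colours) : Set where
      field
        size    : ∀ {u} → u ∈ U → count (col u) X ≡ k
        compat  : ∀ {u w} → u ∈ U → w ∈ U → u ≢ w → ∀ ε → a ε u w ≤ agree ε (col u) (col w)

    eliminated : ∀ {U a v} → Weighted U a → v ∈ U → ∑ (weight a v) U < 2 * L →
                 Weighted (remove v U) (eliminate a v)
    eliminated {U} {a} {v} wt v∈ degree = record
      { a-sym = eliminate-sym a-sym ; a-diag = eliminate-diag ; walk = walk′
      ; dense = dense v∈ (λ ε → a≤L ε v) degree (Weighted.dense wt) }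
      where
      open Weighted wt hiding (dense)
      open AtVertex a v
      walk′ : ∀ {ε u w} → 1 ≤ eliminate a v ε u w →
              ∃ λ m → Walk u w m × isOdd m ≡ ε × m + eliminate a v ε u w ≡ L
      walk′ {ε} {u} {w} pos with eliminate-cases ε u w pos
      ... | inj₁ eq with m , P , par , total ← walk {ε} {u} {w} (subst (1 ≤_) eq pos) =
        m , P , par , trans (cong (m +_) eq) total
      -- The walk follows `P` backwards to `v` and then `Q`; its length is `(L - α) + (L - β)`, as
      -- the new weight requires.
      ... | inj₂ (δ , eq) = m + m′ , reverseʷ P ++ʷ Q
          , trans (isOdd-+ m m′) (trans (cong₂ _xor_ par par′) (trans (sym (xor-assoc δ δ ε)) (cong (_xor ε) (xor-same δ))))
          , trans (cong (m + m′ +_) eq) (+-cancelʳ-≡ L _ _ (trans (+-assoc (m + m′) _ L)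
              (trans (cong (m + m′ +_) (m∸n+n≡m (<⇒≤ big))) (trans (e m m′ α β) (cong₂ _+_ total total′)))))
        where
        α = a δ v u
        β = a (δ xor ε) v w
        big : L < α + β
        big = ≰⇒> λ le → contradiction (subst (1 ≤_) (trans eq (m≤n⇒m∸n≡0 le)) pos) λ ()
        -- No weight exceeds `L`, so a sum above `L` needs two positive weights.
        posα : 1 ≤ α
        posα = +-cancelʳ-≤ L 1 α (≤-trans big (+-monoʳ-≤ α (a≤L (δ xor ε) v w)))
        posβ : 1 ≤ β
        posβ = +-cancelʳ-≤ L 1 β (≤-trans big (≤-trans (+-monoˡ-≤ β (a≤L δ v u)) (≤-reflexive (+-comm L β))))
        m = proj₁ (walk posα)
        P = proj₁ (proj₂ (walk posα))
        par = proj₁ (proj₂ (proj₂ (walk posα)))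
        total = proj₂ (proj₂ (proj₂ (walk posα)))
        m′ = proj₁ (walk posβ)
        Q = proj₁ (proj₂ (walk posβ))
        par′ = proj₁ (proj₂ (proj₂ (walk posβ)))
        total′ = proj₂ (proj₂ (proj₂ (walk posβ)))
        e : ∀ m m′ a b → m + m′ + (a + b) ≡ m + a + (m′ + b)
        e = solve-∀

    open Membership {Fin L} Fin._≟_
    open Selections {Vertex × Bool} {Fin L} (≡-dec Fin._≟_ _≟ᵇ_)

    module Extend {U a v} (wt : Weighted U a) (v∈ : v ∈ U) (unique : Unique U)
      (degree : ∑ (weight a v) U < 2 * L) (col : Colours)
      (proper : Proper (remove v U) (eliminate a v) col) where

      open Weighted wt
      open AtVertex a v using (≤eliminate; via≤eliminate)
      open Proper proper

      -- A `k`-set `A` agrees with `S i` in `2 * |A ∩ S i| + k + 1 - |S i|` coordinates. By the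
      -- parity of a positive `α i`, at least `α i` agreements mean `|A ∩ S i| ≥ n i`.
      α n z : Vertex × Bool → ℕ
      α (u , δ) = a δ v u
      n i = ⌊ α i /2⌋
      z i = ⌈ α i /2⌉

      S : Vertex × Bool → Fin L → Bool
      S (u , δ) c = col u c xor δ

      n+z : ∀ i → n i + z i ≡ α i
      n+z i = ⌊n/2⌋+⌈n/2⌉≡n (α i)

      -- The walk has length `L - α` with `L` odd. For an even edge `α` is odd, so `z` is `n + 1`,
      -- and the set has `k` elements; for an odd edge `α` is even, so `z` is `n`, and the
      -- complement has `k + 1`.
      balance : ∀ {u δ} → u ∈ remove v U → 1 ≤ α (u , δ) → count (S (u , δ)) X + z (u , δ) ≡ n (u , δ) + suc k
      balance {u} {δ} u∈ pos with m , P , par , total ← walk {δ} {v} {u} pos = cases δ par total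
        where
        isOdd-α : ∀ δ → isOdd m ≡ δ → m + a δ v u ≡ L → δ xor isOdd (a δ v u) ≡ true
        isOdd-α δ par total = trans (cong (_xor isOdd (a δ v u)) (sym par))
          (trans (sym (isOdd-+ m (a δ v u))) (trans (cong isOdd total) (isOdd-1+2* k)))
        cases : ∀ δ → isOdd m ≡ δ → m + a δ v u ≡ L →
                count (S (u , δ)) X + z (u , δ) ≡ n (u , δ) + suc k
        cases false par total = trans (cong₂ _+_ (trans (count-cong X λ c → xor-identityʳ (col u c)) (size u∈))
          (⌈n/2⌉-odd (a false v u) (isOdd-α false par total))) (e k (n (u , false)))
          where
          e : ∀ k n → k + suc n ≡ n + suc k
          e = solve-∀
        cases true par total = trans (cong₂ _+_ complement (⌈n/2⌉-even (a true v u)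
          (trans (sym (not-involutive _)) (cong not (isOdd-α true par total))))) (+-comm (suc k) _)
          where
          complement : count (S (u , true)) X ≡ suc k
          complement = +-cancelʳ-≡ k _ _ (trans (cong₂ _+_ (count-cong X λ c → xor-comm (col u c) true) (sym (size u∈)))
            (trans (count-not (col u) X) (trans length-X (e k))))
            where
            e : ∀ k → suc (2 * k) ≡ suc k + k
            e = solve-∀

      J : List (Vertex × Bool)
      J = filter (λ i → 1 ≤? n i) (keys (remove v U))

      module _ {u δ} (i∈ : (u , δ) ∈ J) where

        u∈ : u ∈ remove v U
        u∈ = ∈-keys⁻ (proj₁ (∈-filter⁻ (λ i → 1 ≤? n i) {xs = keys (remove v U)} i∈))

        n>0 : 1 ≤ n (u , δ)
        n>0 = proj₂ (∈-filter⁻ (λ i → 1 ≤? n i) {xs = keys (remove v U)} i∈)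

        α>0 : 1 ≤ α (u , δ)
        α>0 = ≤-trans n>0 (≤-trans (m≤m+n _ _) (≤-reflexive (n+z (u , δ))))

        -- `u` differs from `v`, so the walk has at least one edge.
        α≤2k : α (u , δ) ≤ 2 * k
        α≤2k with walk {δ} {v} {u} α>0
        ... | zero , [] , _ = contradiction refl (proj₂ (∈-remove⁻ {U = U} u∈))
        ... | suc m , _ , _ , total = ≤-trans (m≤n+m _ m) (≤-reflexive (suc-injective total))

        z≤k : z (u , δ) ≤ k
        z≤k = ≤-trans (⌈n/2⌉-mono α≤2k) (≤-reflexive (half k))
          where
          half : ∀ k → ⌈ 2 * k /2⌉ ≡ k
          half zero = refl
          half (suc k) = trans (cong ⌈_/2⌉ (e k)) (cong suc (half k))
            where
            e : ∀ k → 2 * suc k ≡ suc (suc (2 * k))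
            e = solve-∀

      pairs : ∀ {i j} → i ∈ J → j ∈ J → i ≢ j → n i + n j ≤ k + count (both S i j) X
      pairs {i@(u , δ)} {j@(w , ε)} i∈ j∈ i≢j with u Fin.≟ w
      -- The edge created through `v` makes `S i` and `S j` agree in at least `α i + α j - L`
      -- coordinates; `halve` converts agreement into intersection by means of `balance`.
      ... | no u≢w = halve (n i) (z i) (n j) (z j) (count (S i) X) (count (S j) X)
              (count (both S i j) X) (count (λ c → not (S i c xor S j c)) X)
              (balance (u∈ i∈) (α>0 i∈)) (balance (u∈ j∈) (α>0 j∈))
              (trans (count-xnor (S i) (S j) X) (cong (_+ 2 * count (both S i j) X) length-X))
              (subst₂ (λ m o → m + o ≤ L + count (λ c → not (S i c xor S j c)) X) (sym (n+z i)) (sym (n+z j)) agreement)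
        where
        agreement : α i + α j ≤ L + count (λ c → not (S i c xor S j c)) X
        agreement = begin
          α i + α j                                            ≤⟨ m≤n+m∸n (α i + α j) L ⟩
          L + (a δ v u + a ε v w ∸ L)                          ≡⟨ cong (λ b → L + (a δ v u + a b v w ∸ L)) (cancel δ ε) ⟨
          L + via a v δ (δ xor ε) u w                          ≤⟨ +-monoʳ-≤ L (via≤eliminate δ (δ xor ε) u≢w) ⟩
          L + eliminate a v (δ xor ε) u w                      ≤⟨ +-monoʳ-≤ L (compat (u∈ i∈) (u∈ j∈) u≢w (δ xor ε)) ⟩
          L + agree (δ xor ε) (col u) (col w)                  ≡⟨ cong (L +_) (count-cong X λ c → cong not (xor-medial (col u c) δ (col w c) ε)) ⟨
          L + count (λ c → not (S i c xor S j c)) X            ∎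
          where
          open ≤-Reasoning
          cancel : ∀ δ ε → δ xor (δ xor ε) ≡ ε
          cancel δ ε = trans (sym (xor-assoc δ δ ε)) (cong (_xor ε) (xor-same δ))
        halve : ∀ n z n′ z′ s s′ b g → s + z ≡ n + suc k → s′ + z′ ≡ n′ + suc k → g + (s + s′) ≡ L + 2 * b →
                (n + z) + (n′ + z′) ≤ L + g → n + n′ ≤ k + b
        halve n z n′ z′ s s′ b g h₁ h₂ h₃ h₄ = *-cancelˡ-≤ 2 (linear 0
          (+-mono-≤ h₄ (+-mono-≤ (≤-reflexive h₃) (+-mono-≤ (≤-reflexive (sym h₁)) (≤-reflexive (sym h₂)))))
          (e k n z n′ z′ s s′ b g))
          where
          e : ∀ k n z n′ z′ s s′ b g → 2 * (n + n′) + (suc (2 * k) + g + (suc (2 * k) + 2 * b + (s + z + (s′ + z′)))) + 0 ≡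
              2 * (k + b) + (n + z + (n′ + z′) + (g + (s + s′) + (n + suc k + (n′ + suc k))))
          e = solve-∀
      ... | yes refl = ≤-trans (≤-pred (*-cancelˡ-< 2 (n i + n j) (suc k)
              (≤-trans (s≤s (≤-trans opposite (a+a≤L v u))) (≤-reflexive (e k))))) (m≤m+n k _)
        where
        opposite : 2 * (n i + n j) ≤ a false v u + a true v u
        opposite = begin
          2 * (n i + n j)                 ≡⟨ e₁ (n i) (n j) ⟩
          (n i + n i) + (n j + n j)       ≤⟨ +-mono-≤ (+-monoʳ-≤ (n i) (⌊n/2⌋≤⌈n/2⌉ (α i))) (+-monoʳ-≤ (n j) (⌊n/2⌋≤⌈n/2⌉ (α j))) ⟩
          (n i + z i) + (n j + z j)       ≡⟨ cong₂ _+_ (n+z i) (n+z j) ⟩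
          a δ v u + a ε v u               ≡⟨ distinct δ ε (λ δ≡ε → i≢j (cong (u ,_) δ≡ε)) ⟩
          a false v u + a true v u        ∎
          where
          open ≤-Reasoning
          e₁ : ∀ m n → 2 * (m + n) ≡ m + m + (n + n)
          e₁ = solve-∀
          distinct : ∀ δ ε → δ ≢ ε → a δ v u + a ε v u ≡ a false v u + a true v u
          distinct false false δ≢ε = contradiction refl δ≢ε
          distinct false true _ = refl
          distinct true false _ = +-comm (a true v u) _
          distinct true true δ≢ε = contradiction refl δ≢ε
        e : ∀ k → suc (suc (2 * k)) ≡ 2 * suc k
        e = solve-∀

      ∑α<2L : ∑ α J < 2 * L
      ∑α<2L = ≤-trans (s≤s (begin
        ∑ α J                             ≤⟨ ∑-filter-≤ α (λ i → 1 ≤? n i) (keys (remove v U)) ⟩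
        ∑ α (keys (remove v U))           ≡⟨ ∑-keys α (remove v U) ⟩
        ∑ (weight a v) (remove v U)       ≤⟨ ∑-filter-≤ (weight a v) (λ u → ¬? (v Fin.≟ u)) U ⟩
        ∑ (weight a v) U                  ∎)) degree
        where open ≤-Reasoning

      ∑n+∑z : ∑ n J + ∑ z J ≡ ∑ α J
      ∑n+∑z = trans (sym (∑-+ n z J)) (∑-cong J λ {i} _ → n+z i)

      2z∸1≤α : ∀ i → 2 * z i ∸ 1 ≤ α i
      2z∸1≤α i = m≤n+o⇒m∸n≤o (2 * z i) 1 (begin
        2 * z i             ≡⟨ cong (z i +_) (+-identityʳ (z i)) ⟩
        z i + z i           ≤⟨ +-monoˡ-≤ (z i) (⌊n/2⌋-mono (n≤1+n (suc (α i)))) ⟩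
        suc (n i) + z i     ≡⟨ cong suc (n+z i) ⟩
        suc (α i)           ∎)
        where open ≤-Reasoning

      state : State S X k (suc k) J n z
      state = record
        { size = trans length-X (e k)
        ; unique = Unique.filter⁺ (λ i → 1 ≤? n i) (unique-keys (Unique.filter⁺ (λ u → ¬? (v Fin.≟ u)) unique))
        ; n>0 = n>0
        ; z>0 = λ {i} i∈ → ≤-trans (n>0 i∈) (⌊n/2⌋≤⌈n/2⌉ (α i))
        ; n≤r = λ {i} i∈ → ≤-trans (⌊n/2⌋≤⌈n/2⌉ (α i)) (z≤k i∈)
        ; z≤q = λ i∈ → m≤n⇒m≤1+n (z≤k i∈)
        ; bal = λ i∈ → balance (u∈ i∈) (α>0 i∈)
        ; pair = pairs }
        where
        e : ∀ k → suc (2 * k) ≡ k + suc k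
        e = solve-∀

      selection : Selection S X k J n
      selection = select k state total z-bound (λ i∈ → s≤s (z≤k i∈)) ∑n≤2k
        where
        total : ∑ n J + ∑ z J < 2 * k + 2 * suc k
        total = subst₂ _<_ (sym ∑n+∑z) (e k) ∑α<2L
          where
          e : ∀ k → 2 * suc (2 * k) ≡ 2 * k + 2 * suc k
          e = solve-∀
        -- `∑ α J` is at most `2 * L - 1 = 4 * k + 1`, which is exactly `4 * suc k - 3`.
        z-bound : ∑ (λ i → 2 * z i ∸ 1) J + 3 ≤ 4 * suc k
        z-bound = linear 0 (≤-trans (s≤s (∑-mono J λ {i} _ → 2z∸1≤α i)) ∑α<2L)
          (e (∑ (λ i → 2 * z i ∸ 1) J) k)
          where
          e : ∀ m k → m + 3 + 2 * suc (2 * k) + 0 ≡ 4 * suc k + suc m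
          e = solve-∀
        ∑n≤2k : ∑ n J ≤ 2 * k
        ∑n≤2k = ≤-pred (*-cancelˡ-< 2 (∑ n J) (suc (2 * k)) (≤-trans (s≤s (begin
          2 * ∑ n J           ≡⟨ cong (∑ n J +_) (+-identityʳ (∑ n J)) ⟩
          ∑ n J + ∑ n J       ≤⟨ +-monoʳ-≤ (∑ n J) (∑-mono J λ {i} _ → ⌊n/2⌋≤⌈n/2⌉ (α i)) ⟩
          ∑ n J + ∑ z J       ≡⟨ ∑n+∑z ⟩
          ∑ α J               ∎)) ∑α<2L))
          where open ≤-Reasoning

      module Extended (sel : Selection S X k J n) where

        open Selection sel using (chosen; rejected; split; enough) renaming (size to size-chosen)

        new : Fin L → Bool
        new = member chosen

        count-new : ∀ p → count (λ c → new c ∧ p c) X ≡ count p chosen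
        count-new p = count-member {xs = chosen} {ys = rejected} p (Unique.allFin⁺ L) split

        size-new : count new X ≡ k
        size-new = trans (count-cong X λ c → sym (∧-identityʳ (new c)))
          (trans (count-new (λ _ → true)) (trans (∑-1 chosen) size-chosen))

        enough-new : ∀ {u} δ → u ∈ remove v U → n (u , δ) ≤ count (λ c → new c ∧ S (u , δ) c) X
        enough-new {u} δ u∈ with 1 ≤? n (u , δ)
        ... | yes n>0 = ≤-trans (enough (∈-filter⁺ (λ i → 1 ≤? n i) (∈-keys⁺ δ u∈) n>0))
                          (≤-reflexive (sym (count-new (S (u , δ)))))
        ... | no n≯0 = ≤-trans (≤-pred (≰⇒> n≯0)) z≤n

        -- By `count-xnor` and `balance` the agreement is `2 * b - n + z`, where `b` is the size of
        -- the intersection and `n ≤ b`. This includes weight 1, where `n` is 0.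
        compat-new : ∀ {u} δ → u ∈ remove v U → a δ v u ≤ agree δ new (col u)
        compat-new {u} δ u∈ with 1 ≤? a δ v u
        ... | no α≯0 = ≤-trans (≤-pred (≰⇒> α≯0)) z≤n
        ... | yes α>0 = subst₂ _≤_ (n+z (u , δ)) (count-cong X λ c → cong not (sym (xor-assoc (new c) (col u c) δ)))
          (arith (n (u , δ)) (z (u , δ)) (count (S (u , δ)) X) (count (λ c → new c ∧ S (u , δ) c) X)
             (count (λ c → not (new c xor S (u , δ) c)) X) (balance u∈ α>0)
             (trans (cong (λ m → count (λ c → not (new c xor S (u , δ) c)) X + (m + count (S (u , δ)) X)) (sym size-new))
               (trans (count-xnor new (S (u , δ)) X) (cong (_+ 2 * count (λ c → new c ∧ S (u , δ) c) X) length-X)))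
             (enough-new δ u∈))
          where
          arith : ∀ n z s b g → s + z ≡ n + suc k → g + (k + s) ≡ L + 2 * b → n ≤ b → n + z ≤ g
          arith n z s b g h₁ h₂ n≤b = linear 0
            (+-mono-≤ (+-mono-≤ n≤b n≤b) (+-mono-≤ (≤-reflexive (sym h₂)) (≤-reflexive h₁))) (e k n z s b g)
            where
            e : ∀ k n z s b g → n + z + (b + b + (g + (k + s) + (n + suc k))) + 0 ≡
                                g + (n + n + (suc (2 * k) + 2 * b + (s + z)))
            e = solve-∀

        col′ : Colours
        col′ u = if does (v Fin.≟ u) then new else col u

        proper′ : Proper U a col′
        proper′ = record { size = size′ ; compat = compat′ }
          where
          size′ : ∀ {u} → u ∈ U → count (col′ u) X ≡ k
          size′ {u} u∈U with v Fin.≟ u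
          ... | yes _ = size-new
          ... | no v≢u = size (∈-remove⁺ u∈U v≢u)
          compat′ : ∀ {u w} → u ∈ U → w ∈ U → u ≢ w → ∀ ε → a ε u w ≤ agree ε (col′ u) (col′ w)
          compat′ {u} {w} u∈U w∈U u≢w ε with v Fin.≟ u | v Fin.≟ w
          ... | yes refl | yes refl = contradiction refl u≢w
          ... | yes refl | no v≢w = compat-new ε (∈-remove⁺ w∈U v≢w)
          ... | no v≢u | yes refl = subst₂ _≤_ (a-sym ε v u) (agree-sym ε new (col u)) (compat-new ε (∈-remove⁺ u∈U v≢u))
          ... | no v≢u | no v≢w = ≤-trans (≤eliminate ε u≢w) (compat (∈-remove⁺ u∈U v≢u) (∈-remove⁺ w∈U v≢w) u≢w ε)

      extension : ∃ (Proper U a)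
      extension = Extended.col′ selection , Extended.proper′ selection

    -- `N` bounds the number of vertices and carries the recursion, since `remove v U` is not
    -- structurally smaller than `U`.
    colour : ∀ N {U a} → length U ≤ N → Unique U → Weighted U a → ∃ (Proper U a)
    colour _ {[]} _ _ _ = (λ _ _ → false) , record { size = λ () ; compat = λ () }
    colour (suc N) {U@(_ ∷ _)} {a} U≤ unique wt
      with v , v∈ , degree ← low-degree (Weighted.a-sym wt) (Weighted.a-diag wt) unique (Weighted.dense wt) (s≤s z≤n)
      with col , proper ← colour N (≤-pred (≤-trans (filter-notAll (λ u → ¬? (v Fin.≟ u)) U (lose v∈ (λ v≢v → v≢v refl))) U≤))
                            (Unique.filter⁺ (λ u → ¬? (v Fin.≟ u)) unique) (eliminated wt v∈ degree)
      = Extend.extension wt v∈ unique degree col proper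

  -- Maximum average degree

  ∑-map : ∀ {A B : Set} (f : B → ℕ) (g : A → B) xs → ∑ f (map g xs) ≡ ∑ (f ∘ g) xs
  ∑-map f g [] = refl
  ∑-map f g (x ∷ xs) = cong (f (g x) +_) (∑-map f g xs)

  module _ {A : Set} where

    filter∈sublists : ∀ {P : A → Set} (P? : Decidable P) xs → filter P? xs ∈ sublists xs
    filter∈sublists P? [] = here refl
    filter∈sublists P? (x ∷ xs) with P? x
    ... | yes _ = ∈-++⁺ˡ (∈-map⁺ (x ∷_) (filter∈sublists P? xs))
    ... | no _ = ∈-++⁺ʳ (map (x ∷_) (sublists xs)) (filter∈sublists P? xs)

    ∑-filter : ∀ {P : A → Set} (P? : Decidable P) m xs →
               ∑ (λ x → if does (P? x) then m else 0) xs ≡ length (filter P? xs) * m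
    ∑-filter P? m [] = refl
    ∑-filter P? m (x ∷ xs) with does (P? x)
    ... | true = cong (_+_ m) (∑-filter P? m xs)
    ... | false = ∑-filter P? m xs

    ∑-cartesianProduct : ∀ {B : Set} (f : A × B → ℕ) xs ys →
      ∑ f (cartesianProduct xs ys) ≡ ∑ (λ x → ∑ (λ y → f (x , y)) ys) xs
    ∑-cartesianProduct f [] ys = refl
    ∑-cartesianProduct f (x ∷ xs) ys = trans (∑-++ f (map (x ,_) ys))
      (cong₂ _+_ (∑-map f (x ,_) ys) (∑-cartesianProduct f xs ys))

  ratio-bound : ∀ f d k {q} → ℤ.+ (2 * f) ℚ./ suc d ℚ.≤ q → q ℚ.< (ℤ.+ 2 ℚ./ 1) ℚ.+ (ℤ.+ 1 ℚ./ suc k) →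
                2 * f * suc k < suc (2 * suc k) * suc d
  ratio-bound f d k p≤q q< = subst₂ _<_ (cong (2 * f *_) (*-identityˡ (suc k))) (e k d) (ℤ.drop‿+<+
      (subst₂ ℤ._<_ (sym (ℤ.pos-* (2 * f) (1 * suc k))) refl (ℚᵘ.drop-*<* bound)))
    where
    e : ∀ k d → (2 * suc k + 1) * suc d ≡ suc (2 * suc k) * suc d
    e = solve-∀
    open ℚᵘ.≤-Reasoning
    -- Unnormalised fractions keep numerator and denominator visible, whereas `_/_` reduces to
    -- lowest terms; the second argument of `mkℚᵘ` is the denominator minus one.
    bound : mkℚᵘ (ℤ.+ (2 * f)) d ℚᵘ.< mkℚᵘ (ℤ.+ 2) 0 ℚᵘ.+ mkℚᵘ (ℤ.+ 1) k
    bound = begin-strict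
      mkℚᵘ (ℤ.+ (2 * f)) d                              ≃⟨ ℚ.toℚᵘ-fromℚᵘ (mkℚᵘ (ℤ.+ (2 * f)) d) ⟨
      toℚᵘ (ℤ.+ (2 * f) ℚ./ suc d)                        <⟨ ℚ.toℚᵘ-mono-< (ℚ.≤-<-trans p≤q q<) ⟩
      toℚᵘ ((ℤ.+ 2 ℚ./ 1) ℚ.+ (ℤ.+ 1 ℚ./ suc k))              ≃⟨ ℚ.toℚᵘ-homo-+ (ℤ.+ 2 ℚ./ 1) (ℤ.+ 1 ℚ./ suc k) ⟩
      toℚᵘ (ℤ.+ 2 ℚ./ 1) ℚᵘ.+ toℚᵘ (ℤ.+ 1 ℚ./ suc k)          ≃⟨ ℚᵘ.+-cong (ℚ.toℚᵘ-fromℚᵘ (mkℚᵘ (ℤ.+ 2) 0))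
                                                                        (ℚ.toℚᵘ-fromℚᵘ (mkℚᵘ (ℤ.+ 1) k)) ⟩
      mkℚᵘ (ℤ.+ 2) 0 ℚᵘ.+ mkℚᵘ (ℤ.+ 1) k                  ∎

  module Density (G : Graph) (k : ℕ) (sparse : mad G ℚ.< (ℤ.+ 2 ℚ./ 1) ℚ.+ (ℤ.+ 1 ℚ./ suc k)) where
    open Graph G renaming (sym to Adj-sym)

    subgraph-bound : ∀ {W F} → (W , F) ∈ subgraphs G → 2 * length F * suc k < suc (2 * suc k) * length W
    subgraph-bound {[]} H∈ with () ← proj₁ (proj₂ (∈-filter⁻ (isSubgraph? G)
      {xs = cartesianProduct (sublists (allFin order)) (sublists (edges G))} H∈))
    subgraph-bound {w ∷ W} {F} H∈ = ratio-bound (length F) (length W) k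
      (All.lookup (xs≤max ℚ.0ℚ (map (averageDegree G) (subgraphs G))) (∈-map⁺ (averageDegree G) H∈)) sparse

    -- Each edge inside `W` occurs twice, once in each direction.
    arcs : List Vertex → List (Vertex × Vertex)
    arcs W = filter (λ p → adj? (proj₁ p) (proj₂ p)) (cartesianProduct W W)

    arcs-bound : ∀ W → Unique W → 0 < length W → length (arcs W) * suc k < suc (2 * suc k) * length W
    arcs-bound W unique W>0 = ≤-trans (s≤s (*-monoˡ-≤ (suc k) arcs≤2F))
      (≤-trans (subgraph-bound H∈) (*-monoʳ-≤ (suc (2 * suc k)) W′≤W))
      where
      ∈W? : Decidable (_∈ W)
      ∈W? u = _∈?_ Fin._≟_ u W
      -- `W` rearranged in the order of `allFin`, because `sublists` lists each subset only in that
      -- order.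
      W′ : List Vertex
      W′ = filter ∈W? (allFin order)
      W⊆W′ : ∀ {u} → u ∈ W → u ∈ W′
      W⊆W′ {u} = ∈-filter⁺ ∈W? (∈-allFin u)
      W′≤W : length W′ ≤ length W
      W′≤W = length-⊆ (Unique.filter⁺ ∈W? (Unique.allFin⁺ order)) λ u∈ → proj₂ (∈-filter⁻ ∈W? {xs = allFin order} u∈)
      inside? : Decidable (λ (p : Vertex × Vertex) → proj₁ p ∈ W′ × proj₂ p ∈ W′)
      inside? (u , v) = _∈?_ Fin._≟_ u W′ ×-dec _∈?_ Fin._≟_ v W′
      F : List (Vertex × Vertex)
      F = filter inside? (edges G)
      H∈ : (W′ , F) ∈ subgraphs G
      H∈ = ∈-filter⁺ (isSubgraph? G)
        (∈-cartesianProduct⁺ (filter∈sublists ∈W? (allFin order)) (filter∈sublists inside? (edges G)))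
        (≤-trans W>0 (length-⊆ unique W⊆W′) , All.tabulate λ p∈ → proj₂ (∈-filter⁻ inside? {xs = edges G} p∈))
      edge : ∀ {u v} → u ∈ W → v ∈ W → u Fin.< v → Adj u v → (u , v) ∈ F
      edge {u} {v} u∈ v∈ u<v uv = ∈-filter⁺ inside?
        (∈-filter⁺ (λ (u , v) → (u Fin.<? v) ×-dec adj? u v)
          (∈-cartesianProduct⁺ (∈-allFin u) (∈-allFin v)) (u<v , uv))
        (W⊆W′ u∈ , W⊆W′ v∈)
      oriented : ∀ {p} → p ∈ arcs W → p ∈ F ++ map swap F
      oriented {u , v} p∈ with uv∈ , uv ← ∈-filter⁻ (λ p → adj? (proj₁ p) (proj₂ p)) {xs = cartesianProduct W W} p∈
        with u∈ , v∈ ← ∈-cartesianProduct⁻ W W uv∈ | Fin.<-cmp u v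
      ... | tri< u<v _ _ = ∈-++⁺ˡ (edge u∈ v∈ u<v uv)
      ... | tri≈ _ u≡v _ = contradiction uv (irrefl u≡v)
      ... | tri> _ _ v<u = ∈-++⁺ʳ F (∈-map⁺ swap (edge v∈ u∈ v<u (Adj-sym uv)))
      arcs≤2F : length (arcs W) ≤ 2 * length F
      arcs≤2F = ≤-trans (length-⊆ (Unique.filter⁺ (λ p → adj? (proj₁ p) (proj₂ p)) (Unique.cartesianProduct⁺ unique unique)) oriented)
        (≤-reflexive (trans (length-++ F) (cong (_+_ (length F)) (trans (length-map swap F) (sym (+-identityʳ (length F)))))))

  -- The coloring of a sparse graph of large odd girth

  ∣tabulate∣ : ∀ {n} (f : Fin n → Bool) → ∣ Vec.tabulate f ∣ ≡ count f (allFin n)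
  ∣tabulate∣ {zero} f = refl
  ∣tabulate∣ {suc n} f = trans (head (f Fin.zero) {Vec.tabulate (f ∘ Fin.suc)})
    (cong (⟦ f Fin.zero ⟧ +_) (trans (∣tabulate∣ (f ∘ Fin.suc)) shiftˡ))
    where
    head : ∀ b {xs : Subset n} → ∣ b Vec.∷ xs ∣ ≡ ⟦ b ⟧ + ∣ xs ∣
    head true = refl
    head false = refl
    shiftˡ : count (f ∘ Fin.suc) (allFin n) ≡ count f (tabulate Fin.suc)
    shiftˡ = trans (sym (∑-map (λ c → ⟦ f c ⟧) Fin.suc (allFin n))) (cong (count f) (map-tabulate id Fin.suc))

  module SparseGraph (G : Graph) (k-1 : ℕ) (sparse : mad G ℚ.< (ℤ.+ 2 ℚ./ 1) ℚ.+ (ℤ.+ 1 ℚ./ suc k-1))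
    (og : [ suc (2 * suc k-1) ] ≤⁺ oddGirth G) where
    open Graph G renaming (sym to Adj-sym)
    open Walks G
    open Density G k-1 sparse

    k : ℕ
    k = suc k-1

    open Colour G k (oddGirth≤oddWalk og)
    open Elimination {Vertex} Fin._≟_ L

    initial : Weights
    initial false u v = 0
    initial true u v = if does (adj? u v) then 2 * k else 0

    initial-sym : ∀ ε u w → initial ε u w ≡ initial ε w u
    initial-sym false u w = refl
    initial-sym true u w with adj? u w | adj? w u
    ... | yes _ | yes _ = refl
    ... | no _ | no _ = refl
    ... | yes uw | no ¬wu = contradiction (Adj-sym uw) ¬wu
    ... | no ¬uw | yes wu = contradiction (Adj-sym wu) ¬uw

    initial-diag : ∀ ε u → initial ε u u ≡ 0
    initial-diag false u = refl
    initial-diag true u with adj? u u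
    ... | yes uu = contradiction uu (irrefl refl)
    ... | no _ = refl

    initial-walk : ∀ {ε u w} → 1 ≤ initial ε u w → ∃ λ m → Walk u w m × isOdd m ≡ ε × m + initial ε u w ≡ L
    initial-walk {true} {u} {w} pos with adj? u w
    ... | yes uw = 1 , (uw ∷ []) , refl , refl

    -- For e edges inside `W` the claim is 2ke < L|W|, which is 2e/|W| < 2 + 1/k cleared of
    -- denominators; `arcs W` has 2e entries.
    initial-dense : ∀ {U} → Dense initial U
    initial-dense W unique _ W>0 = *-cancelˡ-< 2 (∑∑ (weight initial) W) (L * length W) (begin-strict
      2 * ∑∑ (weight initial) W
        ≡⟨ handshake (λ u w → initial-sym true u w) (initial-diag true) W ⟨
      ∑ (λ u → ∑ (initial true u) W) W
        ≡⟨ ∑-cartesianProduct (λ p → initial true (proj₁ p) (proj₂ p)) W W ⟨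
      ∑ (λ p → initial true (proj₁ p) (proj₂ p)) (cartesianProduct W W)
        ≡⟨ ∑-filter (λ p → adj? (proj₁ p) (proj₂ p)) (2 * k) (cartesianProduct W W) ⟩
      length (arcs W) * (2 * k)
        ≡⟨ e (length (arcs W)) k ⟩
      2 * (length (arcs W) * k)
        <⟨ *-monoʳ-< 2 (arcs-bound W unique W>0) ⟩
      2 * (L * length W) ∎)
      where
      open ≤-Reasoning
      e : ∀ l k → l * (2 * k) ≡ 2 * (l * k)
      e = solve-∀

    proper-colouring : ∃ (Proper (allFin order) initial)
    proper-colouring = colour _ ≤-refl (Unique.allFin⁺ order)
      record { a-sym = initial-sym ; a-diag = initial-diag ; walk = initial-walk ; dense = initial-dense }

    module Subsets (col : Colours) (proper : Proper (allFin order) initial col) where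

      open Proper proper

      disjoint′ : ∀ {u v} → Adj u v → Empty (Vec.tabulate (col u) ∩ Vec.tabulate (col v))
      disjoint′ {u} {v} uv (c , c∈) with c∈u , c∈v ← x∈p∩q⁻ (Vec.tabulate (col u)) _ c∈ =
        <-irrefl refl (begin-strict
          0                                            <⟨ ∃⇒count>0 (λ c → col u c ∧ col v c) (∈-allFin c)
                                                           (cong₂ _∧_ (value u c∈u) (value v c∈v)) ⟩
          count (λ c → col u c ∧ col v c) X            ≤⟨ arith (count (λ c → col u c ∧ col v c) X)
                                                           (agree true (col u) (col v)) agreement balance ⟩
          0                                            ∎)
        where
        open ≤-Reasoning
        value : ∀ w → c ∈ˢ Vec.tabulate (col w) → col w c ≡ true
        value w c∈ = trans (sym (Vec.lookup∘tabulate (col w) c)) (Vec.[]=⇒lookup c∈)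
        agreement : 2 * k ≤ agree true (col u) (col v)
        agreement with adj? u v | compat (∈-allFin u) (∈-allFin v) (λ u≡v → irrefl u≡v uv) true
        ... | yes _ | 2k≤ = 2k≤
        ... | no ¬uv | _ = contradiction uv ¬uv
        -- Two `k`-sets differ in `2 * k` coordinates minus twice the size of their intersection, so
        -- `2 * k` differences leave no common element.
        balance : agree true (col u) (col v) + 2 * count (λ c → col u c ∧ col v c) X ≡ 2 * k
        balance = combine (count (λ c → not (col u c xor col v c)) X) (agree true (col u) (col v)) (count (λ c → col u c ∧ col v c) X)
          (trans (cong₂ (λ l m → count (λ c → not (col u c xor col v c)) X + (l + m)) (sym (size (∈-allFin u))) (sym (size (∈-allFin v))))
            (trans (count-xnor (col u) (col v) X) (cong (_+ 2 * count (λ c → col u c ∧ col v c) X) length-X)))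
          (trans (cong (_+_ (count (λ c → not (col u c xor col v c)) X)) (count-cong X λ c → unnegate (col u c xor col v c)))
            (trans (count-not (λ c → col u c xor col v c) X) length-X))
          where
          unnegate : ∀ b → not (b xor true) ≡ b
          unnegate true = refl
          unnegate false = refl
          combine : ∀ x g b → x + (k + k) ≡ L + 2 * b → x + g ≡ L → g + 2 * b ≡ 2 * k
          combine x g b h₁ h₂ = +-cancelʳ-≡ (x + L) _ _ (trans (e₁ x g b L)
            (trans (cong₂ _+_ h₂ (sym h₁)) (e₂ x k L)))
            where
            e₁ : ∀ x g b L → g + 2 * b + (x + L) ≡ x + g + (L + 2 * b)
            e₁ = solve-∀
            e₂ : ∀ x k L → L + (x + (k + k)) ≡ 2 * k + (x + L)
            e₂ = solve-∀
        arith : ∀ b g → 2 * k ≤ g → g + 2 * b ≡ 2 * k → b ≤ 0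
        arith b g 2k≤g eq = *-cancelˡ-≤ 2 (+-cancelˡ-≤ g _ _ (≤-trans (≤-reflexive eq)
          (≤-trans 2k≤g (≤-reflexive (sym (+-identityʳ g))))))

      coloring : Coloring L k G
      coloring = record
        { color = λ v → Vec.tabulate (col v)
        ; size = λ v → trans (∣tabulate∣ (col v)) (size (∈-allFin v))
        ; disjoint = disjoint′ }

    coloring : Coloring L k G
    coloring = Subsets.coloring (proj₁ proper-colouring) (proj₂ proper-colouring)

open import Data.Nat.Base using (ℕ; suc; NonZero; _≤_; _*_)
open import Data.Integer.Base using (+_)
open import Data.Rational.Base using (_/_; _+_; _<_)

theorem1p2 : ∀ (k : ℕ) .{{_ : NonZero k}} → 2 ≤ k → (G : Graph) →
    [ suc (2 * k) ] ≤⁺ oddGirth G →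
    mad G < (+ 2 / 1) + (+ 1 / k) →
    Coloring (suc (2 * k)) k G
theorem1p2 (suc k-1) _ G og sparse = Proof.SparseGraph.coloring G k-1 sparse og
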